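{- Let $G$ be a maximally edge-connected graph of order $m\geq 3$, and let $n\geq 4$. Then $$\lambda_3(G\boxtimes K_n)=\min\{\,n^2\delta(G),\ (n-1)(m+2e(G)),\ 3n\delta(G)+3n-9\,\}.$$
   Context: Graphs are finite and simple. The order of $G$ is $|V(G)|$, $e(G)=|E(G)|$, and $\delta(G)$ is the minimum degree of $G$. $K_n$ is the complete graph of order $n$. An edge subset $S\subseteq E(G)$ is an edge-cut if $G-S$ is disconnected; the edge-connectivity $\lambda(G)$ is the minimum cardinality of an edge-cut. $G$ is maximally edge-connected if $\lambda(G)=\delta(G)$. An edge subset $S\subseteq E(G)$ is a 3-restricted edge-cut if $G-S$ is disconnected and each component of $G-S$ has at least three vertices. $\lambda_3(G)$ is the minimum cardinality of a 3-restricted edge-cut of $G$ if one exists, and $\lambda_3(G)=+\infty$ otherwise. The strong product $G\boxtimes H$ has vertex set $V(G)\times V(H)$; two distinct vertices $(x_1,y_1)$, $(x_2,y_2)$ are adjacent iff $x_1=x_2$ and $y_1y_2\in E(H)$, or $y_1=y_2$ and $x_1x_2\in E(G)$, or $x_1x_2\in E(G)$ and $y_1y_2\in E(H)$. -}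

module Defs where

open import Data.Fin.Base using (Fin)
import Data.Fin.Properties as Fin
open import Data.List.Base using (List; length; filter; map; allFin; cartesianProduct)
open import Data.List.Extrema.Nat using (min)
open import Data.List.Relation.Unary.All using (All)
open import Data.List.Relation.Unary.Unique.Propositional using (Unique)
open import Data.Nat.Base using (ℕ; _*_; _≤_)
open import Data.Product.Base using (_×_; _,_; proj₁; proj₂; ∃-syntax; Σ-syntax)
open import Data.Product.Function.NonDependent.Propositional using (_×-↔_)
open import Data.Sum.Base using (_⊎_; inj₁; inj₂)
open import Function.Base using (id; _∘_)
open import Function.Bundles using (_↔_; Inverse)
open import Function.Construct.Composition using (_↔-∘_)
open import Function.Construct.Identity using (↔-id)
open import Function.Construct.Symmetry using (↔-sym)
open import Function.Properties.Inverse using (↔⇒↣)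
open import Level using (0ℓ)
open import Relation.Binary.Construct.Closure.ReflexiveTransitive using (Star)
open import Relation.Binary.Core using (Rel)
open import Relation.Binary.Definitions using (Decidable; DecidableEquality; Irreflexive; Symmetric)
open import Relation.Binary.PropositionalEquality using (_≡_; _≢_; refl; sym; ≢-sym)
open import Relation.Nullary.Construct.Add.Supremum using (_⁺; [_]; ⊤⁺)
open import Relation.Nullary.Decidable using (_×-dec_; _⊎-dec_; ¬?)
open import Relation.Nullary.Negation using (¬_)

record Graph : Set₁ where
  infix 4 _~_ _~?_
  field
    V      : Set
    order  : ℕ
    finite : V ↔ Fin order
    _~_    : Rel V 0ℓ
    _~?_   : Decidable _~_
    irrefl : Irreflexive _≡_ _~_
    symm   : Symmetric _~_

  index : V → Fin order
  index = Inverse.to finite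

  vertices : List V
  vertices = map (Inverse.from finite) (allFin order)

  infix 4 _≟_
  _≟_ : DecidableEquality V
  _≟_ = Fin.inj⇒≟ (↔⇒↣ finite)

open Graph public using (V; order)

deg : (G : Graph) → V G → ℕ
deg G u = length (filter (Graph._~?_ G u) (Graph.vertices G))

-- The first argument of min is its value on the empty list. Every degree is
-- less than the order, so it does not affect the minimum of a nonempty graph.
δ : Graph → ℕ
δ G = min (order G) (map (deg G) (Graph.vertices G))

-- A set of (undirected) edges, as a symmetric subrelation of adjacency.
record EdgeSet (G : Graph) : Set₁ where
  open Graph G using (_~_)
  field
    Joins  : Rel (V G) 0ℓ
    joins? : Decidable Joins
    symm   : Symmetric Joins
    sub    : ∀ {u v} → Joins u v → u ~ v

E : (G : Graph) → EdgeSet G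
E G = record { Joins = _~_ ; joins? = _~?_ ; symm = symm ; sub = id }
  where open Graph G

-- Each edge is counted once, with its endpoints in increasing index order.
∣_∣ : {G : Graph} → EdgeSet G → ℕ
∣_∣ {G} S = length (filter (λ (u , v) → (index u Fin.<? index v) ×-dec joins? u v)
                           (cartesianProduct vertices vertices))
  where
  open Graph G
  open EdgeSet S using (joins?)

e : Graph → ℕ
e G = ∣ E G ∣

infixl 6 _-ₑ_
_-ₑ_ : (G : Graph) → EdgeSet G → Graph
G -ₑ S = record
  { V      = V G
  ; order  = order G
  ; finite = finite
  ; _~_    = λ u v → u ~ v × ¬ Joins u v
  ; _~?_   = λ u v → (u ~? v) ×-dec ¬? (joins? u v)
  ; irrefl = λ u≡v → irrefl u≡v ∘ proj₁
  ; symm   = λ (u~v , ¬uv) → symm u~v , ¬uv ∘ S.symm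
  }
  where
  open Graph G hiding (V; order)
  module S = EdgeSet S
  open S using (Joins; joins?)

Reachable : (G : Graph) → Rel (V G) 0ℓ
Reachable G = Star (Graph._~_ G)

Connected : Graph → Set
Connected G = ∀ u v → Reachable G u v

Disconnected : Graph → Set
Disconnected G = ¬ Connected G

-- The components are the classes of Reachable, so each is the component of
-- some vertex v, whose vertices are the u with Reachable G v u.
EachComponentHasAtLeast : ℕ → Graph → Set
EachComponentHasAtLeast k G =
  ∀ v → ∃[ us ] (Unique us × All (Reachable G v) us × k ≤ length us)

IsEdgeCut : (G : Graph) → EdgeSet G → Set
IsEdgeCut G S = Disconnected (G -ₑ S)

Is3RestrictedEdgeCut : (G : Graph) → EdgeSet G → Set
Is3RestrictedEdgeCut G S = Disconnected (G -ₑ S) × EachComponentHasAtLeast 3 (G -ₑ S)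

-- MinSize P x: x is the least size of an edge set satisfying P, with x = ⊤⁺
-- (that is, +∞) when there is no such edge set.
MinSize : {G : Graph} → (EdgeSet G → Set) → ℕ ⁺ → Set₁
MinSize {G} P [ k ] = (Σ[ S ∈ EdgeSet G ] (P S × ∣ S ∣ ≡ k)) × (∀ S → P S → k ≤ ∣ S ∣)
MinSize {G} P ⊤⁺    = ∀ S → ¬ P S

-- The relations "λ(G) = x" and "λ₃(G) = x". A graph of order at most one has
-- no edge-cut; it is given λ = +∞.
infix 4 λ[_]≡_ λ₃[_]≡_
λ[_]≡_ : Graph → ℕ ⁺ → Set₁
λ[ G ]≡ x = MinSize (IsEdgeCut G) x

λ₃[_]≡_ : Graph → ℕ ⁺ → Set₁
λ₃[ G ]≡ x = MinSize (Is3RestrictedEdgeCut G) x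

MaximallyEdgeConnected : Graph → Set₁
MaximallyEdgeConnected G = λ[ G ]≡ [ δ G ]

K : ℕ → Graph
K n = record
  { V      = Fin n
  ; order  = n
  ; finite = ↔-id (Fin n)
  ; _~_    = _≢_
  ; _~?_   = λ i j → ¬? (i Fin.≟ j)
  ; irrefl = λ i≡j i≢j → i≢j i≡j
  ; symm   = ≢-sym
  }

-- Adjacent vertices are automatically distinct, as G and H have no loops.
infixl 7 _⊠_
_⊠_ : Graph → Graph → Graph
G ⊠ H = record
  { V      = V G × V H
  ; order  = order G * order H
  ; finite = ↔-sym Fin.*↔× ↔-∘ (G.finite ×-↔ H.finite)
  ; _~_    = λ (x₁ , y₁) (x₂ , y₂) →
               (x₁ ≡ x₂ × y₁ H.~ y₂) ⊎ (y₁ ≡ y₂ × x₁ G.~ x₂) ⊎ (x₁ G.~ x₂ × y₁ H.~ y₂)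
  ; _~?_   = λ (x₁ , y₁) (x₂ , y₂) →
               ((x₁ G.≟ x₂) ×-dec (y₁ H.~? y₂))
               ⊎-dec (((y₁ H.≟ y₂) ×-dec (x₁ G.~? x₂))
               ⊎-dec ((x₁ G.~? x₂) ×-dec (y₁ H.~? y₂)))
  ; irrefl = λ { refl (inj₁ (_ , y~y))        → H.irrefl refl y~y
               ; refl (inj₂ (inj₁ (_ , x~x))) → G.irrefl refl x~x
               ; refl (inj₂ (inj₂ (x~x , _))) → G.irrefl refl x~x }
  ; symm   = λ { (inj₁ (p , q))        → inj₁ (sym p , H.symm q)
               ; (inj₂ (inj₁ (p , q))) → inj₂ (inj₁ (sym p , G.symm q))
               ; (inj₂ (inj₂ (p , q))) → inj₂ (inj₂ (G.symm p , H.symm q)) }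
  }
  where
  module G = Graph G
  module H = Graph H

{-# OPTIONS --safe #-}
-- Let A be a vertex set of G ⊠ K n with a u vertices in the fibre over u, and
-- b u = n − a u. With c u v = 1 when u and v are equal or adjacent (else 0), A
-- has exactly Σ c u v · a u · b v boundary edges. Hence:
-- * if A has p vertices, the boundary has at least p (n (δ + 1) − p) edges,
--   which settles 3 ≤ p ≤ n (δ + 1) − 3 (third value);
-- * if a u ≥ s and a v = 0, the s nonempty superlevel sets of a are edge cuts
--   of G and give at least n s δ edges; a full and an empty fibre give the
--   first value;
-- * if no fibre is full, there are at least (n − 1) Σ (1 + deg u) edges, summed
--   over the w fibres met by A; if all are met, this is the second value.
-- If δ = 0 the minimum is 0. Otherwise, up to complementing A, there remains
-- the case where no fibre is full, some fibre is empty and p ≥ n (δ + 1) − 2.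
-- For w ≥ 4, and for w = 3 (where δ ≤ 1), the third bound
-- reaches the third value; w = 2 forces δ = 1 and a fibre with n − 1 vertices,
-- so the second bound, with the boundary edges inside the fibres added, gives
-- the first value; w ≤ 1 is impossible.
-- The values are attained by a fibre over a vertex of least degree, by a layer
-- V(G) × {i}, and by a triangle in such a fibre.
module Submission where

open import Defs
open import Data.Bool.Base using (Bool; true; false; not; _∧_; _∨_)
import Data.Bool.Properties as Bool
open import Data.Bool.Properties using (∨-conicalˡ; ∨-conicalʳ)
open import Data.Fin.Base using (Fin; fromℕ<)
import Data.Fin.Base as Fin using (_<_; suc)
open import Data.Fin.Patterns using (0F; 1F; 2F; 3F)
import Data.Fin.Properties as Fin
open import Data.List.Base using (List; []; _∷_; _++_; map; filter; length; tabulate; allFin; cartesianProduct)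
open import Data.List.Membership.Propositional using (_∈_)
open import Data.List.Extrema.Nat using (argmin-sel; min≤xs)
open import Data.List.Membership.Propositional.Properties using (∈-map⁺; ∈-map⁻; ∈-allFin; ∈-cartesianProduct⁺)
open import Data.List.Membership.Propositional.Properties.WithK using (unique∧set⇒bag)
open import Data.List.Properties using (length-map; length-filter; length-tabulate; map-∘; map-++)
open import Data.List.Relation.Binary.BagAndSetEquality using (∼bag⇒↭)
import Data.List.Relation.Binary.Permutation.Propositional.Properties as ↭
open import Data.List.Relation.Unary.All as All using (All; []; _∷_)
import Data.List.Relation.Unary.All.Properties as All
open import Data.List.Relation.Unary.Any as Any using (here; there)
open import Data.List.Relation.Unary.AllPairs using ([]; _∷_)
open import Data.List.Relation.Unary.Unique.Propositional using (Unique)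
import Data.List.Relation.Unary.Unique.Propositional.Properties as Unique
open import Data.Nat.Base using (ℕ; zero; suc; _+_; _*_; _∸_; _^_; _⊓_; _≤_; _<_; _≥_; pred; z≤n; s≤s; s≤s⁻¹; >-nonZero)
open import Data.Nat.ListAction using (sum)
open import Data.Nat.ListAction.Properties using (sum-++; sum-↭)
open import Data.Nat.Properties renaming (_≟_ to _≟ℕ_)
open import Algebra.Properties.CommutativeSemigroup *-commutativeSemigroup using (x∙yz≈y∙xz)
open import Data.Nat.Tactic.RingSolver using (solve-∀)
open import Data.Product.Base using (_×_; _,_; proj₁; proj₂; ∃-syntax; Σ-syntax)
open import Data.Sum.Base using (_⊎_; inj₁; inj₂)
open import Function.Base using (id; _∘_; const)
open import Function.Bundles using (Inverse; Injection; mk⇔)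
open import Function.Construct.Symmetry using (↔-sym)
open import Function.Properties.Inverse using (↔⇒↣)
open import Relation.Binary.Construct.Closure.ReflexiveTransitive using (ε; _◅_; _◅◅_; reverse; gmap)
open import Relation.Binary.Definitions using (DecidableEquality; tri<; tri≈; tri>)
open import Relation.Binary.PropositionalEquality
  using (_≡_; _≢_; refl; sym; trans; cong; cong₂; subst; ≢-sym; module ≡-Reasoning)
open import Relation.Nullary.Construct.Add.Supremum using ([_])
open import Relation.Nullary.Decidable using (Dec; yes; no; does; _×-dec_; ¬?; decidable-stable; dec-true; dec-false; ¬¬-excluded-middle)
open import Relation.Nullary.Negation using (¬_; contradiction)
open import Relation.Unary using (Decidable)

private variable
  A B : Set

-- Indicators of Booleans and decidable propositions

ι : Bool → ℕ
ι true  = 1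
ι false = 0

⟦_⟧ : {P : Set} → Dec P → ℕ
⟦ p? ⟧ = ι (does p?)

⟦⟧-cong : {P Q : Set} (p? : Dec P) (q? : Dec Q) → (P → Q) → (Q → P) → ⟦ p? ⟧ ≡ ⟦ q? ⟧
⟦⟧-cong (yes p) (yes q) f g = refl
⟦⟧-cong (yes p) (no ¬q) f g = contradiction (f p) ¬q
⟦⟧-cong (no ¬p) (yes q) f g = contradiction (g q) ¬p
⟦⟧-cong (no ¬p) (no ¬q) f g = refl

⟦⟧-true : {P : Set} (p? : Dec P) → P → ⟦ p? ⟧ ≡ 1
⟦⟧-true (yes _) _ = refl
⟦⟧-true (no ¬p) p = contradiction p ¬p

⟦⟧-false : {P : Set} (p? : Dec P) → ¬ P → ⟦ p? ⟧ ≡ 0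
⟦⟧-false (yes p) ¬p = contradiction p ¬p
⟦⟧-false (no _)  _  = refl

does-true : {P : Set} (p? : Dec P) → does p? ≡ true → P
does-true (yes p) _ = p

does-false : {P : Set} (p? : Dec P) → does p? ≡ false → ¬ P
does-false (no ¬p) _ = ¬p

ι-not : ∀ b → ι b + ι (not b) ≡ 1
ι-not true  = refl
ι-not false = refl

ι≤1 : ∀ b → ι b ≤ 1
ι≤1 true  = ≤-refl
ι≤1 false = z≤n

-- Finite sums

∑ : List A → (A → ℕ) → ℕ
∑ xs f = sum (map f xs)

infix 10 ∑
syntax ∑ xs (λ x → t) = ∑[ x ← xs ] t

module _ {f g : A → ℕ} where

  ∑-cong : ∀ xs → (∀ x → f x ≡ g x) → ∑ xs f ≡ ∑ xs g
  ∑-cong []       eq = refl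
  ∑-cong (x ∷ xs) eq = cong₂ _+_ (eq x) (∑-cong xs eq)

  ∑-mono : ∀ xs → (∀ x → f x ≤ g x) → ∑ xs f ≤ ∑ xs g
  ∑-mono []       le = z≤n
  ∑-mono (x ∷ xs) le = +-mono-≤ (le x) (∑-mono xs le)

  ∑-+ : ∀ xs → ∑[ x ← xs ] (f x + g x) ≡ ∑ xs f + ∑ xs g
  ∑-+ []       = refl
  ∑-+ (x ∷ xs) = trans (cong (f x + g x +_) (∑-+ xs)) (interchange (f x) (g x) (∑ xs f) (∑ xs g))
    where
    interchange : ∀ a b c d → a + b + (c + d) ≡ a + c + (b + d)
    interchange = solve-∀

  ∑-< : ∀ xs → ∑ xs f < ∑ xs g → ∃[ x ] f x < g x
  ∑-< []       ()
  ∑-< (x ∷ xs) lt with f x <? g x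
  ... | yes fx<gx = x , fx<gx
  ... | no  fx≮gx = ∑-< xs (+-cancelˡ-< (g x) _ _ (≤-<-trans (+-monoˡ-≤ _ (≮⇒≥ fx≮gx)) lt))

∑-pos : ∀ (f : A → ℕ) xs → 0 < ∑ xs f → ∃[ x ] 0 < f x
∑-pos f (x ∷ xs) 0<∑ with f x in fx
... | suc _ = x , subst (0 <_) (sym fx) (s≤s z≤n)
... | zero  = ∑-pos f xs 0<∑

∑-*ˡ : ∀ k {f : A → ℕ} xs → ∑[ x ← xs ] (k * f x) ≡ k * ∑ xs f
∑-*ˡ k []           = sym (*-zeroʳ k)
∑-*ˡ k {f} (x ∷ xs) = trans (cong (k * f x +_) (∑-*ˡ k xs)) (sym (*-distribˡ-+ k (f x) _))

∑-*ʳ : ∀ k {f : A → ℕ} xs → ∑[ x ← xs ] (f x * k) ≡ ∑ xs f * k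
∑-*ʳ k []           = refl
∑-*ʳ k {f} (x ∷ xs) = trans (cong (f x * k +_) (∑-*ʳ k xs)) (sym (*-distribʳ-+ k (f x) _))

∑-const : ∀ k (xs : List A) → ∑[ _ ← xs ] k ≡ length xs * k
∑-const k []       = refl
∑-const k (x ∷ xs) = cong (k +_) (∑-const k xs)

∑-zero : ∀ (xs : List A) → ∑[ _ ← xs ] 0 ≡ 0
∑-zero xs = trans (∑-const 0 xs) (*-zeroʳ (length xs))

∑-tabulate-zero : ∀ n (h : Fin n → A) (f : A → ℕ) → (∀ i → f (h i) ≡ 0) → ∑ (tabulate h) f ≡ 0
∑-tabulate-zero zero    h f f≡0 = refl
∑-tabulate-zero (suc n) h f f≡0 = cong₂ _+_ (f≡0 0F) (∑-tabulate-zero n (h ∘ Fin.suc) f (f≡0 ∘ Fin.suc))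

∑-swap : ∀ (f : A → B → ℕ) xs ys →
         ∑[ x ← xs ] ∑[ y ← ys ] f x y ≡ ∑[ y ← ys ] ∑[ x ← xs ] f x y
∑-swap f []       ys = sym (∑-zero ys)
∑-swap f (x ∷ xs) ys = trans (cong (∑ ys (f x) +_) (∑-swap f xs ys)) (sym (∑-+ ys))

∑-map : ∀ (h : A → B) (f : B → ℕ) xs → ∑ (map h xs) f ≡ ∑ xs (f ∘ h)
∑-map h f xs = cong sum (sym (map-∘ xs))

∑-++ : ∀ (f : A → ℕ) xs ys → ∑ (xs ++ ys) f ≡ ∑ xs f + ∑ ys f
∑-++ f xs ys = trans (cong sum (map-++ f xs ys)) (sum-++ (map f xs) (map f ys))

∑-cartesianProduct : ∀ (f : A × B → ℕ) xs ys →
                     ∑ (cartesianProduct xs ys) f ≡ ∑[ x ← xs ] ∑[ y ← ys ] f (x , y)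
∑-cartesianProduct f []       ys = refl
∑-cartesianProduct f (x ∷ xs) ys = trans (∑-++ f (map (x ,_) ys) _)
  (cong₂ _+_ (∑-map (x ,_) f ys) (∑-cartesianProduct f xs ys))

length-filter-∑ : {P : A → Set} (P? : Decidable P) (xs : List A) →
                  length (filter P? xs) ≡ ∑[ x ← xs ] ⟦ P? x ⟧
length-filter-∑ P? []       = refl
length-filter-∑ P? (x ∷ xs) with P? x
... | yes _ = cong suc (length-filter-∑ P? xs)
... | no  _ = length-filter-∑ P? xs

-- Two duplicate-free lists that contain every element are permutations of each other. This lets
-- `∑-⊠` replace the enumeration of the product graph by the cartesian product of the enumerations
-- of its factors.
∑-↭ : ∀ (f : A → ℕ) {xs ys} → Unique xs → Unique ys → (∀ x → x ∈ xs) → (∀ x → x ∈ ys) →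
      ∑ xs f ≡ ∑ ys f
∑-↭ f uxs uys xs∋ ys∋ =
  sum-↭ (↭.map⁺ f (∼bag⇒↭ (unique∧set⇒bag uxs uys (mk⇔ (const (ys∋ _)) (const (xs∋ _))))))

module _ (_≟_ : DecidableEquality A) (u : A) (f : A → ℕ) where

  ∑-δ-∉ : ∀ xs → All (u ≢_) xs → ∑[ v ← xs ] (⟦ u ≟ v ⟧ * f v) ≡ 0
  ∑-δ-∉ []       []             = refl
  ∑-δ-∉ (x ∷ xs) (u≢x ∷ u∉xs)
    rewrite ⟦⟧-false (u ≟ x) u≢x = ∑-δ-∉ xs u∉xs

  ∑-δ : ∀ xs → Unique xs → u ∈ xs → ∑[ v ← xs ] (⟦ u ≟ v ⟧ * f v) ≡ f u
  ∑-δ (x ∷ xs) (x∉xs ∷ _) (here refl)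
    rewrite ⟦⟧-true (u ≟ u) refl | ∑-δ-∉ xs x∉xs = trans (+-identityʳ _) (+-identityʳ _)
  ∑-δ (x ∷ xs) (x∉xs ∷ uxs) (there u∈xs) with u ≟ x
  ... | yes refl = contradiction refl (All.lookup x∉xs u∈xs)
    where open import Data.List.Relation.Unary.All as All using (lookup)
  ... | no  _    = ∑-δ xs uxs u∈xs

  ∑-δ-≤1 : (∀ x → f x ≡ 1) → ∀ xs → Unique xs → ∑[ v ← xs ] (⟦ u ≟ v ⟧ * f v) ≤ 1
  ∑-δ-≤1 f≡1 []       _              = z≤n
  ∑-δ-≤1 f≡1 (x ∷ xs) (x∉xs ∷ uxs) with u ≟ x
  ... | yes refl rewrite ∑-δ-∉ xs x∉xs = ≤-reflexive (trans (+-identityʳ _) (trans (+-identityʳ _) (f≡1 u)))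
  ... | no  _    = ∑-δ-≤1 f≡1 xs uxs

⟦⟧-mono : {P Q : Set} (p? : Dec P) (q? : Dec Q) → (P → Q) → ⟦ p? ⟧ ≤ ⟦ q? ⟧
⟦⟧-mono (yes p) (yes q) f = ≤-refl
⟦⟧-mono (yes p) (no ¬q) f = contradiction (f p) ¬q
⟦⟧-mono (no ¬p) _       f = z≤n

-- Edge boundaries of vertex sets

module _ (G : Graph) where
  open Graph G hiding (V; order)

  vertices-unique : Unique vertices
  vertices-unique = Unique.map⁺ (Injection.injective (↔⇒↣ (↔-sym finite))) (Unique.allFin⁺ (order G))

  ∈-vertices : ∀ v → v ∈ vertices
  ∈-vertices v = subst (_∈ vertices) (Inverse.strictlyInverseʳ finite v)
                       (∈-map⁺ (Inverse.from finite) (∈-allFin (index v)))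

  length-vertices : length vertices ≡ order G
  length-vertices = trans (length-map _ (allFin (order G))) (length-tabulate id)

  ∑-vertices-const : ∀ k → ∑[ _ ← vertices ] k ≡ order G * k
  ∑-vertices-const k = trans (∑-const k vertices) (cong (_* k) length-vertices)

  ∑-vertices-δ : ∀ u f → ∑[ v ← vertices ] (⟦ u ≟ v ⟧ * f v) ≡ f u
  ∑-vertices-δ u f = ∑-δ _≟_ u f vertices vertices-unique (∈-vertices u)

  -- Expanding each `f u` against a Kronecker delta and exchanging the sums weights `f v` by the
  -- multiplicity of `v` in `us`, which is at most one.
  ∑-unique-≤ : ∀ f us → Unique us → ∑ us f ≤ ∑ vertices f
  ∑-unique-≤ f us uus = begin
    ∑[ u ← us ] f u
      ≡⟨ ∑-cong us (λ u → sym (∑-vertices-δ u f)) ⟩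
    ∑[ u ← us ] ∑[ v ← vertices ] (⟦ u ≟ v ⟧ * f v)
      ≡⟨ ∑-swap (λ u v → ⟦ u ≟ v ⟧ * f v) us vertices ⟩
    ∑[ v ← vertices ] ∑[ u ← us ] (⟦ u ≟ v ⟧ * f v)
      ≤⟨ ∑-mono vertices multiplicity ⟩
    ∑[ v ← vertices ] f v ∎
    where
    open ≤-Reasoning
    multiplicity : ∀ v → ∑[ u ← us ] (⟦ u ≟ v ⟧ * f v) ≤ f v
    multiplicity v = begin
      ∑[ u ← us ] (⟦ u ≟ v ⟧ * f v)     ≡⟨ ∑-*ʳ (f v) us ⟩
      ∑[ u ← us ] ⟦ u ≟ v ⟧ * f v       ≡⟨ cong (_* f v) (∑-cong us (λ u → trans (⟦⟧-cong (u ≟ v) (v ≟ u) sym sym) (sym (*-identityʳ _)))) ⟩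
      ∑[ u ← us ] (⟦ v ≟ u ⟧ * 1) * f v ≤⟨ *-monoˡ-≤ (f v) (∑-δ-≤1 _≟_ v (const 1) (λ _ → refl) us uus) ⟩
      1 * f v                           ≡⟨ *-identityˡ (f v) ⟩
      f v ∎

  -- Turns the duplicate-free witnesses of a component into a lower bound on the size of a vertex
  -- set containing them.
  length-≤-∑ : (A : V G → Bool) {us : List (V G)} → Unique us → All (λ u → A u ≡ true) us →
               length us ≤ ∑[ v ← vertices ] ι (A v)
  length-≤-∑ A {us} uus A-us = subst (_≤ _) (indicators us A-us) (∑-unique-≤ (ι ∘ A) us uus)
    where
    indicators : ∀ us → All (λ u → A u ≡ true) us → ∑ us (ι ∘ A) ≡ length us
    indicators []       []         = refl
    indicators (u ∷ us) (Au ∷ Aus) rewrite Au = cong suc (indicators us Aus)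

  adj : V G → V G → ℕ
  adj u v = ⟦ u ~? v ⟧

  adj-sym : ∀ u v → adj u v ≡ adj v u
  adj-sym u v = ⟦⟧-cong (u ~? v) (v ~? u) symm symm

  -- An edge counted with increasing indices reappears reversed in the transposed sum, and
  -- irreflexivity clears the diagonal. Doubling thus removes the index order from the count.
  2*∣_∣ : (S : EdgeSet G) → 2 * ∣ S ∣ ≡ ∑[ u ← vertices ] ∑[ v ← vertices ] ⟦ EdgeSet.joins? S u v ⟧
  2*∣ S ∣ = begin
    2 * ∣ S ∣
      ≡⟨ cong (2 *_) (trans (length-filter-∑ _ (cartesianProduct vertices vertices)) (∑-cartesianProduct _ vertices vertices)) ⟩
    2 * (∑[ u ← vertices ] ∑[ v ← vertices ] s u v)
      ≡⟨ cong (T +_) (+-identityʳ T) ⟩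
    T + T
      ≡⟨ cong (T +_) (∑-swap s vertices vertices) ⟩
    T + (∑[ u ← vertices ] ∑[ v ← vertices ] s v u)
      ≡⟨ sym (∑-+ vertices) ⟩
    ∑[ u ← vertices ] (∑[ v ← vertices ] s u v + ∑[ v ← vertices ] s v u)
      ≡⟨ ∑-cong vertices (λ u → sym (∑-+ vertices)) ⟩
    ∑[ u ← vertices ] ∑[ v ← vertices ] (s u v + s v u)
      ≡⟨ ∑-cong vertices (λ u → ∑-cong vertices (orient u)) ⟩
    ∑[ u ← vertices ] ∑[ v ← vertices ] ⟦ joins? u v ⟧ ∎
    where
    open ≡-Reasoning
    open EdgeSet S using (Joins; joins?; sub) renaming (symm to S-symm)
    s? : ∀ u v → Dec ((index u Fin.< index v) × Joins u v)
    s? u v = (index u Fin.<? index v) ×-dec joins? u v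
    s : V G → V G → ℕ
    s u v = ⟦ s? u v ⟧
    T = ∑[ u ← vertices ] ∑[ v ← vertices ] s u v
    orient : ∀ u v → s u v + s v u ≡ ⟦ joins? u v ⟧
    orient u v with Fin.<-cmp (index u) (index v)
    ... | tri< lt _ ¬gt = trans (cong₂ _+_ (⟦⟧-cong (s? u v) (joins? u v) proj₂ (lt ,_))
                                           (⟦⟧-false (s? v u) (¬gt ∘ proj₁)))
                                (+-identityʳ _)
    ... | tri> ¬lt _ gt = cong₂ _+_ (⟦⟧-false (s? u v) (¬lt ∘ proj₁))
                                    (⟦⟧-cong (s? v u) (joins? u v) (S-symm ∘ proj₂) (λ j → gt , S-symm j))
    ... | tri≈ ¬lt eq ¬gt = trans (cong₂ _+_ (⟦⟧-false (s? u v) (¬lt ∘ proj₁)) (⟦⟧-false (s? v u) (¬gt ∘ proj₁)))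
                                  (sym (⟦⟧-false (joins? u v) (irrefl (Injection.injective (↔⇒↣ finite) eq) ∘ sub)))

  ∣∣-mono : (S T : EdgeSet G) → (∀ {u v} → EdgeSet.Joins S u v → EdgeSet.Joins T u v) → ∣ S ∣ ≤ ∣ T ∣
  ∣∣-mono S T S⊆T = *-cancelˡ-≤ 2 (begin
    2 * ∣ S ∣                                                      ≡⟨ 2*∣ S ∣ ⟩
    ∑[ u ← vertices ] ∑[ v ← vertices ] ⟦ EdgeSet.joins? S u v ⟧
      ≤⟨ ∑-mono vertices (λ u → ∑-mono vertices (λ v → ⟦⟧-mono (EdgeSet.joins? S u v) (EdgeSet.joins? T u v) S⊆T)) ⟩
    ∑[ u ← vertices ] ∑[ v ← vertices ] ⟦ EdgeSet.joins? T u v ⟧   ≡⟨ sym 2*∣ T ∣ ⟩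
    2 * ∣ T ∣                                                      ∎)
    where open ≤-Reasoning

  ∂ : (V G → Bool) → EdgeSet G
  ∂ A = record
    { Joins  = λ u v → u ~ v × A u ≢ A v
    ; joins? = λ u v → (u ~? v) ×-dec ¬? (A u Bool.≟ A v)
    ; symm   = λ (u~v , Au≢Av) → symm u~v , ≢-sym Au≢Av
    ; sub    = proj₁
    }

  -- Exactly one of the two orientations of a boundary edge leads out of `A`, so the sum over
  -- outgoing pairs counts each edge once.
  ∣∂_∣ : (A : V G → Bool) →
         ∣ ∂ A ∣ ≡ ∑[ u ← vertices ] ∑[ v ← vertices ] (adj u v * (ι (A u) * ι (not (A v))))
  ∣∂ A ∣ = *-cancelˡ-≡ _ _ 2 (begin
    2 * ∣ ∂ A ∣
      ≡⟨ 2*∣ ∂ A ∣ ⟩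
    ∑[ u ← vertices ] ∑[ v ← vertices ] ⟦ EdgeSet.joins? (∂ A) u v ⟧
      ≡⟨ ∑-cong vertices (λ u → trans (∑-cong vertices (pointwise u)) (∑-+ vertices)) ⟩
    ∑[ u ← vertices ] (∑[ v ← vertices ] s u v + ∑[ v ← vertices ] s v u)
      ≡⟨ ∑-+ vertices ⟩
    T + (∑[ u ← vertices ] ∑[ v ← vertices ] s v u)
      ≡⟨ cong (T +_) (sym (∑-swap s vertices vertices)) ⟩
    T + T
      ≡⟨ cong (T +_) (sym (+-identityʳ T)) ⟩
    2 * T ∎)
    where
    open ≡-Reasoning
    s : V G → V G → ℕ
    s u v = adj u v * (ι (A u) * ι (not (A v)))
    T = ∑[ u ← vertices ] ∑[ v ← vertices ] s u v
    table : ∀ p a b → ι (p ∧ not (does (a Bool.≟ b))) ≡ ι p * (ι a * ι (not b)) + ι p * (ι b * ι (not a))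
    table true  true  true  = refl
    table true  true  false = refl
    table true  false true  = refl
    table true  false false = refl
    table false _     _     = refl
    pointwise : ∀ u v → ⟦ EdgeSet.joins? (∂ A) u v ⟧ ≡ s u v + s v u
    pointwise u v = trans (table (does (u ~? v)) (A u) (A v))
                          (cong (s u v +_) (cong (_* (ι (A v) * ι (not (A u)))) (adj-sym u v)))

  -- No edge that survives the removal of `∂ A` changes the value of `A`, so `A` is constant along
  -- paths.
  ∂-isEdgeCut : (A : V G → Bool) {u v : V G} → A u ≡ true → A v ≡ false → IsEdgeCut G (∂ A)
  ∂-isEdgeCut A Au Av conn = contradiction (trans (sym Au) (trans (invariant (conn _ _)) Av)) λ ()
    where
    invariant : ∀ {u v} → Reachable (G -ₑ ∂ A) u v → A u ≡ A v
    invariant ε = refl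
    invariant ((u~w , ¬∂uw) ◅ p) = trans (decidable-stable (_ Bool.≟ _) (λ Au≢Aw → ¬∂uw (u~w , Au≢Aw))) (invariant p)

-- Closed degrees and weighted cuts

positive : ℕ → Bool
positive zero    = false
positive (suc _) = true

sgn : ℕ → ℕ
sgn = ι ∘ positive

module _ (G : Graph) where
  open Graph G hiding (V; order)

  -- Adjacency with a loop added at each vertex. Distinct vertices of `G ⊠ K n` over `u` and `v` are
  -- adjacent exactly when this is 1 (`adj-⊠`).
  adj⁺ : V G → V G → ℕ
  adj⁺ u v = ⟦ u ≟ v ⟧ + adj G u v

  deg⁺ : V G → ℕ
  deg⁺ u = ∑[ v ← vertices ] adj⁺ u v

  adj⁺-sym : ∀ u v → adj⁺ u v ≡ adj⁺ v u
  adj⁺-sym u v = cong₂ _+_ (⟦⟧-cong (u ≟ v) (v ≟ u) sym sym) (adj-sym G u v)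

  adj⁺≤1 : ∀ u v → adj⁺ u v ≤ 1
  adj⁺≤1 u v with u ≟ v
  ... | yes refl = ≤-reflexive (cong₂ _+_ (⟦⟧-true (u ≟ u) refl) (⟦⟧-false (u ~? u) (irrefl refl)))
  ... | no  u≢v  = ≤-trans (≤-reflexive (cong (_+ adj G u v) (⟦⟧-false (u ≟ v) u≢v))) (ι≤1 (does (u ~? v)))

  ∑-≟ : ∀ u → ∑[ v ← vertices ] ⟦ u ≟ v ⟧ ≡ 1
  ∑-≟ u = trans (∑-cong vertices (λ v → sym (*-identityʳ _))) (∑-vertices-δ G u (const 1))

  deg⁺≡1+deg : ∀ u → deg⁺ u ≡ suc (deg G u)
  deg⁺≡1+deg u = trans (∑-+ vertices) (cong₂ _+_ (∑-≟ u) (sym (length-filter-∑ (u ~?_) vertices)))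

  ∑-deg⁺ : ∑ vertices deg⁺ ≡ order G + 2 * e G
  ∑-deg⁺ = begin
    ∑[ u ← vertices ] ∑[ v ← vertices ] adj⁺ u v
      ≡⟨ ∑-cong vertices (λ u → trans (∑-+ vertices) (cong (_+ ∑ vertices (adj G u)) (∑-≟ u))) ⟩
    ∑[ u ← vertices ] (1 + ∑ vertices (adj G u))
      ≡⟨ ∑-+ vertices ⟩
    ∑[ u ← vertices ] 1 + ∑[ u ← vertices ] ∑ vertices (adj G u)
      ≡⟨ cong₂ _+_ (trans (∑-vertices-const G 1) (*-identityʳ (order G))) (sym (2*∣_∣ G (E G))) ⟩
    order G + 2 * e G ∎
    where open ≡-Reasoning

  δ≤deg : ∀ u → δ G ≤ deg G u
  δ≤deg u = All.lookup (min≤xs (order G) (map (deg G) vertices)) (∈-map⁺ (deg G) (∈-vertices G u))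

  1+δ≤deg⁺ : ∀ u → suc (δ G) ≤ deg⁺ u
  1+δ≤deg⁺ u = ≤-trans (s≤s (δ≤deg u)) (≤-reflexive (sym (deg⁺≡1+deg u)))

  deg≤order : ∀ u → deg G u ≤ order G
  deg≤order u = ≤-trans (length-filter (u ~?_) vertices) (≤-reflexive (length-vertices G))

  minDegree : V G → ∃[ u ] deg G u ≡ δ G
  minDegree v with argmin-sel id (order G) (map (deg G) vertices)
  -- The default value `order G` is the minimum only if no degree is smaller; as no degree exceeds
  -- it either, `v` attains it.
  ... | inj₁ δ≡order = v , ≤-antisym (≤-trans (deg≤order v) (≤-reflexive (sym δ≡order))) (δ≤deg v)
  ... | inj₂ δ∈degs  with u , _ , δ≡deg ← ∈-map⁻ (deg G) δ∈degs = u , sym δ≡deg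

  -- If A is a vertex set of G ⊠ K n with a u vertices in the fibre over u and
  -- b u = n − a u outside it, then A has exactly cut a b boundary edges.
  cut : (a b : V G → ℕ) → ℕ
  cut a b = ∑[ u ← vertices ] ∑[ v ← vertices ] (adj⁺ u v * (a u * b v))

  cut-sym : ∀ a b → cut a b ≡ cut b a
  cut-sym a b = trans (∑-swap (λ u v → adj⁺ u v * (a u * b v)) vertices vertices)
    (∑-cong vertices λ u → ∑-cong vertices λ v → cong₂ _*_ (adj⁺-sym v u) (*-comm (a v) (b u)))

  -- The diagonal terms are the boundary edges inside fibres, the remaining ones those between
  -- fibres over adjacent vertices.
  cut-split : ∀ a b → cut a b ≡
    ∑[ u ← vertices ] (a u * b u) + ∑[ u ← vertices ] ∑[ v ← vertices ] (adj G u v * (a u * b v))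
  cut-split a b = trans (∑-cong vertices (λ u →
      trans (∑-cong vertices (λ v → *-distribʳ-+ (a u * b v) ⟦ u ≟ v ⟧ (adj G u v)))
     (trans (∑-+ vertices) (cong (_+ ∑[ v ← vertices ] (adj G u v * (a u * b v))) (∑-vertices-δ G u (λ v → a u * b v))))))
    (∑-+ vertices)

  -- Taken at `b = a`, this bounds by p² the ordered pairs of equal or adjacent vertices within a
  -- set of p vertices.
  cut≤∑*∑ : ∀ a b → cut a b ≤ ∑ vertices a * ∑ vertices b
  cut≤∑*∑ a b = begin
    cut a b
      ≤⟨ ∑-mono vertices (λ u → ∑-mono vertices (λ v → *-monoˡ-≤ (a u * b v) (adj⁺≤1 u v))) ⟩
    ∑[ u ← vertices ] ∑[ v ← vertices ] (1 * (a u * b v))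
      ≡⟨ ∑-cong vertices (λ u → trans (∑-cong vertices (λ v → *-identityˡ (a u * b v))) (∑-*ˡ (a u) vertices)) ⟩
    ∑[ u ← vertices ] (a u * ∑ vertices b)
      ≡⟨ ∑-*ʳ (∑ vertices b) vertices ⟩
    ∑ vertices a * ∑ vertices b ∎
    where open ≤-Reasoning

  module _ (n : ℕ) {a b : V G → ℕ} (a+b≡n : ∀ u → a u + b u ≡ n) where

    -- As `a v + b v = n`, the two terms together count, for each vertex of the set over `u`, its
    -- whole closed neighbourhood in the product, of size `n * deg⁺ u`.
    cut-complement : cut a b + cut a a ≡ n * ∑[ u ← vertices ] (a u * deg⁺ u)
    cut-complement = begin
      cut a b + cut a a
        ≡⟨ sym (∑-+ vertices) ⟩
      ∑[ u ← vertices ] (∑[ v ← vertices ] (adj⁺ u v * (a u * b v)) + ∑[ v ← vertices ] (adj⁺ u v * (a u * a v)))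
        ≡⟨ ∑-cong vertices (λ u → trans (sym (∑-+ vertices)) (∑-cong vertices (merge u))) ⟩
      ∑[ u ← vertices ] ∑[ v ← vertices ] (n * (a u * adj⁺ u v))
        ≡⟨ ∑-cong vertices (λ u → trans (∑-*ˡ n vertices) (cong (n *_) (∑-*ˡ (a u) vertices))) ⟩
      ∑[ u ← vertices ] (n * (a u * deg⁺ u))
        ≡⟨ ∑-*ˡ n vertices ⟩
      n * ∑[ u ← vertices ] (a u * deg⁺ u) ∎
      where
      open ≡-Reasoning
      identity : ∀ c x y z → c * (x * z) + c * (x * y) ≡ (y + z) * (x * c)
      identity = solve-∀
      merge : ∀ u v → adj⁺ u v * (a u * b v) + adj⁺ u v * (a u * a v) ≡ n * (a u * adj⁺ u v)
      merge u v = trans (identity (adj⁺ u v) (a u) (a v) (b v)) (cong (_* (a u * adj⁺ u v)) (a+b≡n v))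

    -- Closed degrees are at least δ + 1, and at most p² of the counted pairs stay inside the set.
    -- The square is added on the right to avoid truncated subtraction.
    cut-degree-bound : n * (∑ vertices a * suc (δ G)) ≤ cut a b + ∑ vertices a * ∑ vertices a
    cut-degree-bound = begin
      n * (∑ vertices a * suc (δ G))             ≡⟨ cong (n *_) (sym (∑-*ʳ (suc (δ G)) vertices)) ⟩
      n * ∑[ u ← vertices ] (a u * suc (δ G))
        ≤⟨ *-monoʳ-≤ n (∑-mono vertices (λ u → *-monoʳ-≤ (a u) (1+δ≤deg⁺ u))) ⟩
      n * ∑[ u ← vertices ] (a u * deg⁺ u)       ≡⟨ sym cut-complement ⟩
      cut a b + cut a a                          ≤⟨ +-monoʳ-≤ (cut a b) (cut≤∑*∑ a a) ⟩
      cut a b + ∑ vertices a * ∑ vertices a      ∎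
      where open ≤-Reasoning

    -- Both sides doubled, the inequality holds term by term: for p, p' ≥ 1 and
    -- q, q' ≥ 1 with p + q = p' + q' = n, one has p q' + p' q ≥ 2 (n − 1).
    cut-support-bound : (∀ u → 1 ≤ b u) → (n ∸ 1) * ∑[ u ← vertices ] (sgn (a u) * deg⁺ u) ≤ cut a b
    cut-support-bound 1≤b = *-cancelˡ-≤ 2 (begin
      2 * (k * R)
        ≡⟨ double k R ⟩
      k * (R + R)
        ≡⟨ cong (λ t → k * (t + t)) (∑-cong vertices (λ u → sym (∑-*ˡ (sgn (a u)) vertices))) ⟩
      k * (R' + R')
        ≡⟨ cong (λ t → k * (R' + t)) (∑-swap (λ u v → sgn (a u) * adj⁺ u v) vertices vertices) ⟩
      k * (R' + ∑[ u ← vertices ] ∑[ v ← vertices ] (sgn (a v) * adj⁺ v u))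
        ≡⟨ cong (k *_) (sym (∑-+₂ _ _)) ⟩
      k * ∑[ u ← vertices ] ∑[ v ← vertices ] (sgn (a u) * adj⁺ u v + sgn (a v) * adj⁺ v u)
        ≡⟨ sym (trans (∑-cong vertices (λ u → ∑-*ˡ k vertices)) (∑-*ˡ k vertices)) ⟩
      ∑[ u ← vertices ] ∑[ v ← vertices ] (k * (sgn (a u) * adj⁺ u v + sgn (a v) * adj⁺ v u))
        ≤⟨ ∑-mono vertices (λ u → ∑-mono vertices (pointwise u)) ⟩
      ∑[ u ← vertices ] ∑[ v ← vertices ] (adj⁺ u v * (a u * b v) + adj⁺ u v * (b u * a v))
        ≡⟨ ∑-+₂ _ _ ⟩
      cut a b + cut b a
        ≡⟨ cong (cut a b +_) (trans (cut-sym b a) (sym (+-identityʳ _))) ⟩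
      2 * cut a b ∎)
      where
      open ≤-Reasoning
      k = n ∸ 1
      R = ∑[ u ← vertices ] (sgn (a u) * deg⁺ u)
      R' = ∑[ u ← vertices ] ∑[ v ← vertices ] (sgn (a u) * adj⁺ u v)
      double : ∀ k r → 2 * (k * r) ≡ k * (r + r)
      double = solve-∀
      ∑-+₂ : ∀ (f g : V G → V G → ℕ) → ∑[ u ← vertices ] ∑[ v ← vertices ] (f u v + g u v) ≡
        ∑[ u ← vertices ] ∑[ v ← vertices ] f u v + ∑[ u ← vertices ] ∑[ v ← vertices ] g u v
      ∑-+₂ f g = trans (∑-cong vertices (λ u → ∑-+ vertices)) (∑-+ vertices)
      bilinear : ∀ p q p' q' → 1 ≤ q → 1 ≤ q' → p + q ≡ n → p' + q' ≡ n →
                 k * (sgn p + sgn p') ≤ p * q' + q * p'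
      bilinear zero q zero q' _ _ _ _ = ≤-trans (≤-reflexive (*-zeroʳ k)) z≤n
      bilinear zero q (suc p') q' _ _ refl _ = begin
        (q ∸ 1) * 1   ≡⟨ *-identityʳ (q ∸ 1) ⟩
        q ∸ 1         ≤⟨ m∸n≤m q 1 ⟩
        q             ≤⟨ m≤m*n q (suc p') ⟩
        q * suc p'    ∎
      bilinear (suc p) q zero q' _ _ _ refl = begin
        (q' ∸ 1) * 1        ≡⟨ *-identityʳ (q' ∸ 1) ⟩
        q' ∸ 1              ≤⟨ m∸n≤m q' 1 ⟩
        q'                  ≤⟨ m≤m+n q' (p * q') ⟩
        suc p * q'          ≤⟨ m≤m+n _ (q * 0) ⟩
        suc p * q' + q * 0  ∎
      -- Expanding in the predecessors of all four numbers leaves 2 (n - 1) plus the slack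
      -- `p * q' + q * p'`.
      bilinear (suc p) (suc q) (suc p') (suc q') _ _ refl eq = begin
        (p + suc q) * 2                                         ≡⟨ expand₁ p q ⟩
        (p + suc q) + (p + suc q)                               ≡⟨ cong ((p + suc q) +_) (sym (suc-injective eq)) ⟩
        (p + suc q) + (p' + suc q')                             ≤⟨ m≤m+n _ (p * q' + q * p') ⟩
        (p + suc q) + (p' + suc q') + (p * q' + q * p')         ≡⟨ expand₂ p q p' q' ⟩
        suc p * suc q' + suc q * suc p'                         ∎
        where
        expand₁ : ∀ p q → (p + suc q) * 2 ≡ (p + suc q) + (p + suc q)
        expand₁ = solve-∀
        expand₂ : ∀ p q p' q' → (p + suc q) + (p' + suc q') + (p * q' + q * p') ≡ suc p * suc q' + suc q * suc p'
        expand₂ = solve-∀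
      pointwise : ∀ u v → k * (sgn (a u) * adj⁺ u v + sgn (a v) * adj⁺ v u) ≤
                          adj⁺ u v * (a u * b v) + adj⁺ u v * (b u * a v)
      pointwise u v = begin
        k * (sgn (a u) * adj⁺ u v + sgn (a v) * adj⁺ v u)
          ≡⟨ cong (λ c → k * (sgn (a u) * adj⁺ u v + sgn (a v) * c)) (adj⁺-sym v u) ⟩
        k * (sgn (a u) * adj⁺ u v + sgn (a v) * adj⁺ u v)
          ≡⟨ factor k (sgn (a u)) (sgn (a v)) (adj⁺ u v) ⟩
        adj⁺ u v * (k * (sgn (a u) + sgn (a v)))
          ≤⟨ *-monoʳ-≤ (adj⁺ u v) (bilinear (a u) (b u) (a v) (b v) (1≤b u) (1≤b v) (a+b≡n u) (a+b≡n v)) ⟩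
        adj⁺ u v * (a u * b v + b u * a v)
          ≡⟨ *-distribˡ-+ (adj⁺ u v) _ _ ⟩
        adj⁺ u v * (a u * b v) + adj⁺ u v * (b u * a v) ∎
        where
        factor : ∀ k x y c → k * (x * c + y * c) ≡ c * (k * (x + y))
        factor = solve-∀

  search : {P : V G → Set} → Decidable P → (∃[ v ] P v) ⊎ (∀ v → ¬ P v)
  search P? with Any.any? P? vertices
  ... | yes any = inj₁ (Any.satisfied any)
  ... | no ¬any = inj₂ (λ v Pv → ¬any (Any.map (λ { refl → Pv }) (∈-vertices G v)))

  -- The form in which maximal edge-connectivity enters: the boundary of a vertex set that is
  -- neither empty nor full is an edge cut.
  BoundariesAtLeastδ : Set
  BoundariesAtLeastδ = ∀ (A : V G → Bool) {u v} → A u ≡ true → A v ≡ false → δ G ≤ ∣ ∂ G A ∣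

  module _ (δ≤∂ : BoundariesAtLeastδ) where

    -- Layer by layer: each of the s superlevel sets { a ≥ 1 }, …, { a ≥ s } has at least δ boundary edges.
    spread : ∀ s a {u v} → s ≤ a u → a v ≡ 0 →
             s * δ G ≤ ∑[ u ← vertices ] ∑[ v ← vertices ] (adj G u v * (a u ∸ a v))
    spread zero    a _ _ = z≤n
    spread (suc s) a {u} {v} s<au av≡0 = begin
      δ G + s * δ G
        -- Passing to `pred ∘ a` lowers every superlevel set by one level, so the induction covers
        -- the levels above the first.
        ≤⟨ +-mono-≤ (δ≤∂ X (positive⁺ s<au) (cong positive av≡0)) (spread s (pred ∘ a) (pred-mono-≤ s<au) (cong pred av≡0)) ⟩
      ∣ ∂ G X ∣ + ∑[ u ← vertices ] ∑[ v ← vertices ] (adj G u v * (pred (a u) ∸ pred (a v)))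
        ≡⟨ cong (_+ ∑[ u ← vertices ] ∑[ v ← vertices ] (adj G u v * (pred (a u) ∸ pred (a v)))) (∣∂_∣ G X) ⟩
      ∑[ u ← vertices ] ∑[ v ← vertices ] (adj G u v * (ι (X u) * ι (not (X v))))
        + ∑[ u ← vertices ] ∑[ v ← vertices ] (adj G u v * (pred (a u) ∸ pred (a v)))
        ≡⟨ sym (trans (∑-cong vertices (λ u → ∑-+ vertices)) (∑-+ vertices)) ⟩
      ∑[ u ← vertices ] ∑[ v ← vertices ]
        (adj G u v * (ι (X u) * ι (not (X v))) + adj G u v * (pred (a u) ∸ pred (a v)))
        ≤⟨ ∑-mono vertices (λ u → ∑-mono vertices (λ v →
             ≤-trans (≤-reflexive (sym (*-distribˡ-+ (adj G u v) _ _))) (*-monoʳ-≤ (adj G u v) (layer (a u) (a v))))) ⟩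
      ∑[ u ← vertices ] ∑[ v ← vertices ] (adj G u v * (a u ∸ a v)) ∎
      where
      open ≤-Reasoning
      X : V G → Bool
      X = positive ∘ a
      positive⁺ : ∀ {m n} → m < n → positive n ≡ true
      positive⁺ (s≤s _) = refl
      -- A pair leaving `X` uses up one unit of `p ∸ q`; for every other pair, lowering both values
      -- leaves the truncated difference unchanged.
      layer : ∀ p q → ι (positive p) * ι (not (positive q)) + (pred p ∸ pred q) ≤ p ∸ q
      layer zero    zero    = z≤n
      layer zero    (suc q) = ≤-reflexive (0∸n≡0 q)
      layer (suc p) zero    = ≤-refl
      layer (suc p) (suc q) = ≤-refl

    -- For each edge, `a u * b v` is a u (n - a v), which exceeds n (a u - a v) by a v (n - a u) ≥
    -- 0; the rest is `spread`. The edges inside fibres are kept because `cut-two-fibres` needs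
    -- them.
    cut-spread-bound : ∀ n {a b} → (∀ u → a u + b u ≡ n) → ∀ s {u v} → s ≤ a u → a v ≡ 0 →
                       ∑[ u ← vertices ] (a u * b u) + n * (s * δ G) ≤ cut a b
    cut-spread-bound n {a} {b} a+b≡n s {u} {v} s≤au av≡0 = begin
      ∑[ u ← vertices ] (a u * b u) + n * (s * δ G)
        ≤⟨ +-monoʳ-≤ _ (*-monoʳ-≤ n (spread s a {u} {v} s≤au av≡0)) ⟩
      ∑[ u ← vertices ] (a u * b u) + n * ∑[ u ← vertices ] ∑[ v ← vertices ] (adj G u v * (a u ∸ a v))
        ≡⟨ cong (∑[ u ← vertices ] (a u * b u) +_) (sym (trans (∑-cong vertices (λ u → ∑-*ˡ n vertices)) (∑-*ˡ n vertices))) ⟩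
      ∑[ u ← vertices ] (a u * b u) + ∑[ u ← vertices ] ∑[ v ← vertices ] (n * (adj G u v * (a u ∸ a v)))
        ≤⟨ +-monoʳ-≤ _ (∑-mono vertices (λ u → ∑-mono vertices (pointwise u))) ⟩
      ∑[ u ← vertices ] (a u * b u) + ∑[ u ← vertices ] ∑[ v ← vertices ] (adj G u v * (a u * b v))
        ≡⟨ sym (cut-split a b) ⟩
      cut a b ∎
      where
      open ≤-Reasoning
      pointwise : ∀ u v → n * (adj G u v * (a u ∸ a v)) ≤ adj G u v * (a u * b v)
      pointwise u v = begin
        n * (adj G u v * (a u ∸ a v))    ≡⟨ x∙yz≈y∙xz n (adj G u v) (a u ∸ a v) ⟩
        adj G u v * (n * (a u ∸ a v))    ≤⟨ *-monoʳ-≤ (adj G u v) (begin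
          n * (a u ∸ a v)                ≡⟨ *-distribˡ-∸ n (a u) (a v) ⟩
          n * a u ∸ n * a v              ≤⟨ ∸-monoʳ-≤ (n * a u) (*-monoˡ-≤ (a v) (m+n≤o⇒m≤o (a u) (≤-reflexive (a+b≡n u)))) ⟩
          n * a u ∸ a u * a v            ≡⟨ cong (_∸ a u * a v) (*-comm n (a u)) ⟩
          a u * n ∸ a u * a v            ≡⟨ sym (*-distribˡ-∸ (a u) n (a v)) ⟩
          a u * (n ∸ a v)                ≡⟨ cong (λ t → a u * (t ∸ a v)) (sym (a+b≡n v)) ⟩
          a u * (a v + b v ∸ a v)        ≡⟨ cong (a u *_) (m+n∸m≡n (a v) (b v)) ⟩
          a u * b v                      ∎) ⟩
        adj G u v * (a u * b v)          ∎

    -- The lower bound, by the distribution over fibres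

    module _ (k : ℕ) (3≤k : 3 ≤ k) (3≤m : 3 ≤ order G) (1≤δ : 1 ≤ δ G) where

      private
        n = suc k
        D = suc (δ G)

      bound : ℕ
      bound = (n ^ 2 * δ G) ⊓ ((n ∸ 1) * (order G + 2 * e G)) ⊓ (3 * n * δ G + 3 * n ∸ 9)

      bound≤₁ : ∀ {q} → n * (n * δ G) ≤ q → bound ≤ q
      bound≤₁ le = ≤-trans (m⊓n≤m _ _) (≤-trans (m⊓n≤m _ _) (≤-trans (≤-reflexive (square n (δ G))) le))
        where
        square : ∀ n d → (n * (n * 1)) * d ≡ n * (n * d)
        square = solve-∀

      bound≤₂ : ∀ {q} → k * (order G + 2 * e G) ≤ q → bound ≤ q
      bound≤₂ le = ≤-trans (m⊓n≤m _ _) (≤-trans (m⊓n≤n (n ^ 2 * δ G) _) le)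

      -- The third value is 3 n D - 9; its subtracted 9 is moved to the other side.
      bound≤₃ : ∀ {q} → 3 * (n * D) ≤ 9 + q → bound ≤ q
      bound≤₃ le = ≤-trans (m⊓n≤n ((n ^ 2 * δ G) ⊓ (k * (order G + 2 * e G))) _)
        (m≤n+o⇒m∸n≤o _ 9 (≤-trans (≤-reflexive (regroup n (δ G))) le))
        where
        regroup : ∀ n d → 3 * n * d + 3 * n ≡ 3 * (n * suc d)
        regroup = solve-∀

      module _ {a b : V G → ℕ} (a+b≡n : ∀ u → a u + b u ≡ n) where

        -- With r = n D - p - 3, the degree bound p (n D - p) exceeds 3 (n D - 3) by (p - 3) r,
        -- which is nonnegative throughout this range.
        cut-few-vertices : 3 ≤ ∑ vertices a → ∑ vertices a + 3 ≤ n * D → bound ≤ cut a b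
        cut-few-vertices 3≤p p+3≤nD = bound≤₃ (+-cancelʳ-≤ (p * p) _ _ (begin
          3 * (n * D) + p * p            ≡⟨ cong (λ t → 3 * t + p * p) (sym nD≡) ⟩
          3 * (p + 3 + r) + p * p        ≡⟨ expand p r ⟩
          9 + (3 * r + 3 * p + p * p)    ≤⟨ +-monoʳ-≤ 9 (+-monoˡ-≤ (p * p) (+-monoˡ-≤ (3 * p) (*-monoˡ-≤ r 3≤p))) ⟩
          9 + (p * r + 3 * p + p * p)    ≡⟨ cong (9 +_) (factor p r) ⟩
          9 + (p * (p + 3 + r))          ≡⟨ cong (λ t → 9 + p * t) nD≡ ⟩
          9 + (p * (n * D))              ≡⟨ cong (9 +_) (x∙yz≈y∙xz p n D) ⟩
          9 + (n * (p * D))              ≤⟨ +-monoʳ-≤ 9 (cut-degree-bound n a+b≡n) ⟩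
          9 + (cut a b + p * p)          ≡⟨ sym (+-assoc 9 (cut a b) (p * p)) ⟩
          9 + cut a b + p * p            ∎))
          where
          open ≤-Reasoning
          p = ∑ vertices a
          r = n * D ∸ (p + 3)
          nD≡ : p + 3 + r ≡ n * D
          nD≡ = m+[n∸m]≡n p+3≤nD
          expand : ∀ p r → 3 * (p + 3 + r) + p * p ≡ 9 + (3 * r + 3 * p + p * p)
          expand = solve-∀
          factor : ∀ p r → p * r + 3 * p + p * p ≡ p * (p + 3 + r)
          factor = solve-∀

        module _ (1≤b : ∀ u → 1 ≤ b u) where

          private
            p = ∑ vertices a
            w = ∑ vertices (sgn ∘ a)

          a≤k : ∀ u → a u ≤ k
          a≤k u = s≤s⁻¹ (begin
            suc (a u)   ≡⟨ +-comm 1 (a u) ⟩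
            a u + 1     ≤⟨ +-monoʳ-≤ (a u) (1≤b u) ⟩
            a u + b u   ≡⟨ a+b≡n u ⟩
            n           ∎)
            where open ≤-Reasoning

          -- When every fibre is met, the support bound sums all closed degrees, giving m + 2 e.
          cut-full-support : (∀ u → 1 ≤ a u) → bound ≤ cut a b
          cut-full-support 1≤a = bound≤₂ (subst (λ t → k * t ≤ cut a b)
            (trans (∑-cong vertices (λ u → trans (cong (_* deg⁺ u) (sgn≡1 (1≤a u))) (*-identityˡ (deg⁺ u)))) ∑-deg⁺)
            (cut-support-bound n a+b≡n 1≤b))
            where
            sgn≡1 : ∀ {m} → 1 ≤ m → sgn m ≡ 1
            sgn≡1 (s≤s _) = refl

          ∑a≤ : ∀ t → (∀ u → a u ≤ t) → p ≤ t * w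
          ∑a≤ t a≤t = ≤-trans (∑-mono vertices (λ u → scale (a u) (a≤t u))) (≤-reflexive (∑-*ˡ t vertices))
            where
            scale : ∀ m → m ≤ t → m ≤ t * sgn m
            scale zero    _  = z≤n
            scale (suc m) le = ≤-trans le (≤-reflexive (sym (*-identityʳ t)))

          cut≥kwD : k * (w * D) ≤ cut a b
          cut≥kwD = ≤-trans (*-monoʳ-≤ k (begin
            w * D                                  ≡⟨ sym (∑-*ʳ D vertices) ⟩
            ∑[ u ← vertices ] (sgn (a u) * D)      ≤⟨ ∑-mono vertices (λ u → *-monoʳ-≤ (sgn (a u)) (1+δ≤deg⁺ u)) ⟩
            ∑[ u ← vertices ] (sgn (a u) * deg⁺ u) ∎))
            (cut-support-bound n a+b≡n 1≤b)
            where open ≤-Reasoning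

          -- A fibre that is met but not full is a clique split into two nonempty sides, with at
          -- least n - 1 edges between them.
          kw≤∑ab : k * w ≤ ∑[ u ← vertices ] (a u * b u)
          kw≤∑ab = ≤-trans (≤-reflexive (sym (∑-*ˡ k vertices)))
            (∑-mono vertices (λ u → product (a u) (b u) (1≤b u) (a+b≡n u)))
            where
            product : ∀ p q → 1 ≤ q → p + q ≡ n → k * sgn p ≤ p * q
            product zero    q       _ _    = ≤-reflexive (*-zeroʳ k)
            product (suc p) (suc q) _ refl = ≤-trans (m≤m+n _ (p * q)) (≤-reflexive (expand p q))
              where
              expand : ∀ p q → (p + suc q) * 1 + p * q ≡ suc p * suc q
              expand = solve-∀

          -- Here D = 2, so two fibres share at least 2 n - 2 vertices and one of them has at least
          -- `k`. The layers of that fibre and the edges inside both fibres together give the first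
          -- value.
          cut-two-fibres : w ≡ 2 → n * D ≤ p + 2 → ∀ {v} → a v ≡ 0 → δ G ≡ 1 → bound ≤ cut a b
          cut-two-fibres w≡2 nD≤p+2 {v} av≡0 δ≡1 with search (λ u → k ≤? a u)
          -- Were both fibres to hold at most k - 1 vertices, p + 2 would be at most 2 k, below n D
          -- = 2 k + 2.
          ... | inj₂ none = contradiction (begin
            suc (k * 2)        ≤⟨ ≤-trans (n≤1+n _) (≤-reflexive (expand k)) ⟩
            n * 2              ≡⟨ cong (λ t → n * suc t) (sym δ≡1) ⟩
            n * D              ≤⟨ nD≤p+2 ⟩
            p + 2              ≤⟨ +-monoˡ-≤ 2 (∑a≤ (pred k) (λ u → pred-mono-≤ (≰⇒> (none u)))) ⟩
            pred k * w + 2     ≡⟨ cong (λ t → pred k * t + 2) w≡2 ⟩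
            pred k * 2 + 2     ≡⟨ +-comm (pred k * 2) 2 ⟩
            suc (pred k) * 2   ≡⟨ cong (_* 2) (suc-pred k {{>-nonZero (≤-trans (s≤s z≤n) 3≤k)}}) ⟩
            k * 2              ∎) 1+n≰n
            where
            open ≤-Reasoning
            expand : ∀ k → suc (suc (k * 2)) ≡ suc k * 2
            expand = solve-∀
          -- The bound obtained is n k + 2 k, and n² = n k + k + 1.
          ... | inj₁ (u , k≤au) = bound≤₁ (begin
            n * (n * δ G)                                  ≡⟨ cong (λ t → n * (n * t)) δ≡1 ⟩
            n * (n * 1)                                    ≡⟨ expand k ⟩
            1 + (k + n * (k * 1))                          ≤⟨ +-monoˡ-≤ (k + n * (k * 1)) (≤-trans (s≤s z≤n) 3≤k) ⟩
            k + (k + n * (k * 1))                          ≡⟨ regroup k (n * (k * 1)) ⟩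
            k * 2 + n * (k * 1)                            ≡⟨ cong₂ (λ s t → k * s + n * (k * t)) (sym w≡2) (sym δ≡1) ⟩
            k * w + n * (k * δ G)                          ≤⟨ +-monoˡ-≤ (n * (k * δ G)) kw≤∑ab ⟩
            ∑[ u ← vertices ] (a u * b u) + n * (k * δ G)  ≤⟨ cut-spread-bound n a+b≡n k {u} {v} k≤au av≡0 ⟩
            cut a b                                        ∎)
            where
            open ≤-Reasoning
            expand : ∀ k → suc k * (suc k * 1) ≡ 1 + (k + suc k * (k * 1))
            expand = solve-∀
            regroup : ∀ k t → k + (k + t) ≡ k * 2 + t
            regroup = solve-∀

          cut-many-vertices : n * D ≤ p + 2 → ∀ {v} → a v ≡ 0 → bound ≤ cut a b
          cut-many-vertices nD≤p+2 {v} av≡0 = byFibres w refl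
            where
            open ≤-Reasoning
            nD≤ : ∀ {t} → w ≡ t → n * D ≤ k * t + 2
            nD≤ refl = ≤-trans nD≤p+2 (+-monoˡ-≤ 2 (∑a≤ k a≤k))

            2≤D : 2 ≤ D
            2≤D = s≤s 1≤δ

            -- Having p ≤ k w turns many vertices on few fibres into a small degree: n D ≤ k w + 2 <
            -- n (t + 1) forces D ≤ t.
            D≤ : ∀ t {s} → w ≡ s → k * s + 2 < n * suc t → D ≤ t
            D≤ t w≡s lt = s≤s⁻¹ (*-cancelˡ-< n D (suc t) (≤-<-trans (nD≤ w≡s) lt))

            byFibres : ∀ t → w ≡ t → bound ≤ cut a b
            byFibres 0 w≡0 = contradiction (≤-trans 2≤D (D≤ 1 w≡0 (begin-strict
              k * 0 + 2   ≡⟨ cong (_+ 2) (*-zeroʳ k) ⟩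
              2           <⟨ s≤s (s≤s (s≤s z≤n)) ⟩
              4 * 2       ≤⟨ *-monoˡ-≤ 2 (s≤s 3≤k) ⟩
              n * 2       ∎))) 1+n≰n
            byFibres 1 w≡1 = contradiction (≤-trans 2≤D (D≤ 1 w≡1 (begin-strict
              k * 1 + 2       <⟨ m<m+n (k * 1 + 2) (≤-trans (s≤s z≤n) 3≤k) ⟩
              k * 1 + 2 + k   ≡⟨ identity k ⟩
              n * 2           ∎))) 1+n≰n
              where
              identity : ∀ k → k * 1 + 2 + k ≡ suc k * 2
              identity = solve-∀
            byFibres 2 w≡2 = cut-two-fibres w≡2 nD≤p+2 av≡0
              (≤-antisym (s≤s⁻¹ (D≤ 2 w≡2 (begin-strict
                k * 2 + 2         <⟨ m<m+n (k * 2 + 2) (s≤s z≤n) ⟩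
                k * 2 + 2 + n     ≡⟨ identity k ⟩
                n * 3             ∎))) 1≤δ)
              where
              identity : ∀ k → k * 2 + 2 + suc k ≡ suc k * 3
              identity = solve-∀
            -- The support bound gives 3 k D, short of 3 n D by 3 D; since D ≤ 2, the 9 to spare
            -- covers this.
            byFibres 3 w≡3 = bound≤₃ (begin
              3 * (n * D)         ≡⟨ identity₂ k D ⟩
              3 * D + k * (3 * D) ≤⟨ +-mono-≤ (*-monoʳ-≤ 3 (≤-trans D≤2 (n≤1+n 2)))
                                              (≤-trans (≤-reflexive (cong (λ t → k * (t * D)) (sym w≡3))) cut≥kwD) ⟩
              9 + cut a b         ∎)
              where
              identity₁ : ∀ k → suc (k * 3 + 2) ≡ suc k * 3
              identity₁ = solve-∀
              identity₂ : ∀ k d → 3 * (suc k * d) ≡ 3 * d + k * (3 * d)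
              identity₂ = solve-∀
              D≤2 : D ≤ 2
              D≤2 = D≤ 2 w≡3 (≤-reflexive (identity₁ k))
            -- The missing 3 D is now paid by the fourth fibre, which contributes k D.
            byFibres t@(suc (suc (suc (suc _)))) w≡t = bound≤₃ (begin
              3 * (n * D)           ≡⟨ identity₁ k D ⟩
              3 * D + k * (3 * D)   ≤⟨ +-monoˡ-≤ (k * (3 * D)) (*-monoˡ-≤ D 3≤k) ⟩
              k * D + k * (3 * D)   ≡⟨ identity₂ k D ⟩
              k * (4 * D)           ≤⟨ *-monoʳ-≤ k (*-monoˡ-≤ D {4} {t} (s≤s (s≤s (s≤s (s≤s z≤n))))) ⟩
              k * (t * D)           ≡⟨ cong (λ t → k * (t * D)) (sym w≡t) ⟩
              k * (w * D)           ≤⟨ cut≥kwD ⟩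
              cut a b               ≤⟨ m≤n+m (cut a b) 9 ⟩
              9 + cut a b           ∎)
              where
              identity₁ : ∀ k d → 3 * (suc k * d) ≡ 3 * d + k * (3 * d)
              identity₁ = solve-∀
              identity₂ : ∀ k d → k * d + k * (3 * d) ≡ k * (4 * d)
              identity₂ = solve-∀

          cut-no-full-fibre : 3 ≤ p → bound ≤ cut a b
          cut-no-full-fibre 3≤p with p + 3 ≤? n * D
          ... | yes few  = cut-few-vertices 3≤p few
          ... | no  many with search (λ v → a v ≟ℕ 0)
          ...   | inj₁ (v , av≡0) = cut-many-vertices
                    (s≤s⁻¹ (≤-trans (≰⇒> many) (≤-reflexive (+-suc p 2)))) {v} av≡0
          ...   | inj₂ none       = cut-full-support (λ u → n≢0⇒n>0 (none u))

      cut-lower-bound : ∀ {a b} → (∀ u → a u + b u ≡ n) → 3 ≤ ∑ vertices a → 3 ≤ ∑ vertices b → bound ≤ cut a b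
      cut-lower-bound {a} {b} a+b≡n 3≤a 3≤b with search (λ u → b u ≟ℕ 0) | search (λ v → a v ≟ℕ 0)
      ... | inj₂ noFull      | _                 = cut-no-full-fibre a+b≡n (λ u → n≢0⇒n>0 (noFull u)) 3≤a
      -- No fibre is empty, so exchanging the set with its complement leaves no full fibre.
      ... | inj₁ _           | inj₂ noEmpty      = subst (bound ≤_) (cut-sym b a)
        (cut-no-full-fibre (λ u → trans (+-comm (b u) (a u)) (a+b≡n u)) (λ u → n≢0⇒n>0 (noEmpty u)) 3≤b)
      -- A full fibre and an empty one allow all n layers in the spread bound.
      ... | inj₁ (u , bu≡0)  | inj₁ (v , av≡0)   = bound≤₁ (≤-trans (m≤n+m _ (∑[ u ← vertices ] (a u * b u)))
        (cut-spread-bound n a+b≡n n {u} {v} (≤-reflexive n≡au) av≡0))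
        where
        n≡au : n ≡ a u
        n≡au = trans (sym (a+b≡n u)) (trans (cong (a u +_) bu≡0) (+-identityʳ (a u)))

-- Edge cuts and reachability

module _ (G : Graph) where
  open Graph G hiding (V; order)

  ∃-∉ : (A : V G → Bool) → ∑[ v ← vertices ] ι (A v) < order G → ∃[ v ] A v ≡ false
  ∃-∉ A small with ∑-< vertices (≤-trans small (≤-reflexive (sym (trans (∑-vertices-const G 1) (*-identityʳ (order G))))))
  ... | v , Av<1 = v , zero⁻ (A v) Av<1
    where
    zero⁻ : ∀ b → ι b < 1 → b ≡ false
    zero⁻ false _ = refl
    zero⁻ true  (s≤s ())

  ≟-true : ∀ u → does (u ≟ u) ≡ true
  ≟-true u = dec-true (u ≟ u) refl

  -- The boundary count is at least δ ≥ 1, and a positive double sum has a positive term, from which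
  -- the edge is read off.
  boundaryEdge : 1 ≤ δ G → BoundariesAtLeastδ G → (A : V G → Bool) {u v : V G} → A u ≡ true → A v ≡ false →
                 ∃[ x ] ∃[ y ] (x ~ y × A x ≡ true × A y ≡ false)
  boundaryEdge 1≤δ δ≤∂ A Au Av
    = proj₁ row , proj₁ term , positive-term (proj₁ row ~? proj₁ term) (A (proj₁ row)) (A (proj₁ term)) (proj₂ term)
    where
    s : V G → V G → ℕ
    s u v = adj G u v * (ι (A u) * ι (not (A v)))
    row : ∃[ x ] 0 < ∑[ y ← vertices ] s x y
    row = ∑-pos (λ x → ∑[ y ← vertices ] s x y) vertices (subst (1 ≤_) (∣∂_∣ G A) (≤-trans 1≤δ (δ≤∂ A Au Av)))
    term : ∃[ y ] 0 < s (proj₁ row) y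
    term = ∑-pos (s (proj₁ row)) vertices (proj₂ row)
    positive-term : ∀ {P : Set} (p? : Dec P) a b → 0 < ⟦ p? ⟧ * (ι a * ι (not b)) → P × a ≡ true × b ≡ false
    positive-term (yes p) true false _ = p , refl , refl

  module _ (1≤δ : 1 ≤ δ G) (δ≤∂ : BoundariesAtLeastδ G) (3≤m : 3 ≤ order G) where

    exit : (A : V G → Bool) (u : V G) → A u ≡ true → ∑[ v ← vertices ] ι (A v) ≤ 2 →
           ∃[ x ] ∃[ y ] (x ~ y × A x ≡ true × A y ≡ false)
    exit A u Au small = boundaryEdge 1≤δ δ≤∂ A Au (proj₂ (∃-∉ A (≤-trans (s≤s small) 3≤m)))

    neighbour : ∀ x → ∃[ y ] (x ~ y)
    neighbour x = fromEdge (exit (λ v → does (x ≟ v)) x (≟-true x) (≤-trans (≤-reflexive (∑-≟ G x)) (n≤1+n 1)))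
      where
      fromEdge : ∃[ w ] ∃[ y ] (w ~ y × does (x ≟ w) ≡ true × does (x ≟ y) ≡ false) → ∃[ y ] (x ~ y)
      fromEdge (w , y , w~y , x≡w , _) = y , subst (_~ y) (sym (does-true (x ≟ w) x≡w)) w~y

    -- Since m ≥ 3, a set of at most two vertices is proper and has an edge leaving it: one such
    -- edge extends {x} to {x, y}, another adds z. This serves the layer cut, one side of which is a
    -- copy of `G`.
    threeReachable : EachComponentHasAtLeast 3 G
    threeReachable x = extend (proj₁ (neighbour x)) (proj₂ (neighbour x))
      where
      pair : V G → V G → Bool
      pair y v = does (x ≟ v) ∨ does (y ≟ v)
      ∑-pair : ∀ y → ∑[ v ← vertices ] ι (pair y v) ≤ 2
      ∑-pair y = ≤-trans (∑-mono vertices (λ v → union (does (x ≟ v)) (does (y ≟ v))))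
        (≤-reflexive (trans (∑-+ vertices) (cong₂ _+_ (∑-≟ G x) (∑-≟ G y))))
        where
        union : ∀ a b → ι (a ∨ b) ≤ ι a + ι b
        union true  b = s≤s z≤n
        union false b = ≤-refl
      Triple : Set
      Triple = ∃[ us ] (Unique us × All (Reachable G x) us × 3 ≤ length us)
      triple : ∀ y → x ~ y → ∃[ w ] ∃[ z ] (w ~ z × pair y w ≡ true × pair y z ≡ false) → Triple
      triple y x~y (w , z , w~z , w∈ , z∉) =
        x ∷ y ∷ z ∷ []
        , ((λ x≡y → irrefl x≡y x~y) ∷ x≢z ∷ []) ∷ (y≢z ∷ []) ∷ [] ∷ []
        , ε ∷ (x~y ◅ ε) ∷ reach (x ≟ w) (y ≟ w) w∈ ∷ []
        , ≤-refl
        where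
        x≢z : x ≢ z
        x≢z = does-false (x ≟ z) (∨-conicalˡ _ _ z∉)
        y≢z : y ≢ z
        y≢z = does-false (y ≟ z) (∨-conicalʳ (does (x ≟ z)) _ z∉)
        reach : (p? : Dec (x ≡ w)) (q? : Dec (y ≡ w)) → does p? ∨ does q? ≡ true → Reachable G x z
        reach (yes refl) _          _ = w~z ◅ ε
        reach (no _)     (yes refl) _ = x~y ◅ w~z ◅ ε
      extend : ∀ y → x ~ y → Triple
      extend y x~y = triple y x~y (exit (pair y) x (cong (_∨ does (y ≟ x)) (≟-true x)) (∑-pair y))

  sameSide : (A : V G → Bool) {u v : V G} → u ~ v → A u ≡ A v → Reachable (G -ₑ ∂ G A) u v
  sameSide A u~v Au≡Av = (u~v , λ (_ , Au≢Av) → Au≢Av Au≡Av) ◅ ε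

  -- Each instance of excluded middle is not refutable, and finitely many of them combine under
  -- double negation.
  ¬¬-decidable : (R : V G → V G → Set) → ¬ ¬ (∀ u v → Dec (R u v))
  ¬¬-decidable R ¬dec = ¬¬-All (cartesianProduct vertices vertices)
    (λ all → ¬dec (λ u v → All.lookup all (∈-cartesianProduct⁺ (∈-vertices G u) (∈-vertices G v))))
    where
    ¬¬-All : ∀ xs → ¬ ¬ All (λ (u , v) → Dec (R u v)) xs
    ¬¬-All []       k = k []
    ¬¬-All (x ∷ xs) k = ¬¬-excluded-middle (λ dec → ¬¬-All xs (λ decs → k (dec ∷ decs)))

  module _ (S : EdgeSet G) where
    open EdgeSet S using (Joins; joins?) renaming (symm to S-symm)

    -- Take `C` to be the component of a vertex `u` that does not reach some `v`. Every edge leaving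
    -- `C` must lie in `S`, and the components of `u` and `v` supply three vertices on each side.
    restrictedCut-≥ : ∀ {q} → (∀ A → 3 ≤ ∑[ v ← vertices ] ι (A v) → 3 ≤ ∑[ v ← vertices ] ι (not (A v)) → q ≤ ∣ ∂ G A ∣) →
                      Is3RestrictedEdgeCut G S → q ≤ ∣ S ∣
    restrictedCut-≥ {q} q≤∂ (disconnected , components) =
      decidable-stable (q ≤? ∣ S ∣) (λ q≰S → ¬¬-decidable (Reachable (G -ₑ S)) (q≰S ∘ separate))
      where
      -- Reachability is decidable only up to ¬¬, which suffices for the stable goal q ≤ ∣ S ∣.
      separate : (∀ u v → Dec (Reachable (G -ₑ S) u v)) → q ≤ ∣ S ∣
      separate reach? with search G (λ u → unreached? u)
        where
        unreached? : ∀ u → Dec (∃[ v ] ¬ Reachable (G -ₑ S) u v)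
        unreached? u with search G (λ v → ¬? (reach? u v))
        ... | inj₁ unreached = yes unreached
        ... | inj₂ none      = no λ (v , ¬r) → none v ¬r
      ... | inj₂ none = contradiction
              (λ u v → decidable-stable (reach? u v) (λ ¬r → none u (v , ¬r))) disconnected
      ... | inj₁ (u , v , ¬u→v)
        with us , uus , u→us , 3≤us ← components u
        with vs , uvs , v→vs , 3≤vs ← components v
        = ≤-trans (q≤∂ C (≤-trans 3≤us (length-≤-∑ G C uus (All.map (dec-true (reach? u _)) u→us)))
                         (≤-trans 3≤vs (length-≤-∑ G (not ∘ C) uvs (All.map outside v→vs))))
                  (∣∣-mono G (∂ G C) S ∂C⊆S)
        where
        C : V G → Bool
        C w = does (reach? u w)
        outside : ∀ {w} → Reachable (G -ₑ S) v w → not (C w) ≡ true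
        outside {w} v→w = cong not (dec-false (reach? u w) (λ u→w → ¬u→v (u→w ◅◅ reverse (Graph.symm (G -ₑ S)) v→w)))
        crossing : ∀ {x y} → x ~ y → Reachable (G -ₑ S) u x → ¬ Reachable (G -ₑ S) u y → Joins x y
        crossing {x} {y} x~y u→x ¬u→y =
          decidable-stable (joins? x y) (λ ¬xy → ¬u→y (u→x ◅◅ (x~y , ¬xy) ◅ ε))
        ∂C⊆S : ∀ {x y} → x ~ y × C x ≢ C y → Joins x y
        ∂C⊆S {x} {y} (x~y , Cx≢Cy) with reach? u x | reach? u y
        ... | yes r | yes s = contradiction refl Cx≢Cy
        ... | yes r | no ¬s = crossing x~y r ¬s
        ... | no ¬r | yes s = S-symm (crossing (symm x~y) s ¬r)
        ... | no ¬r | no ¬s = contradiction refl Cx≢Cy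

-- Strong products with complete graphs

module _ (G : Graph) (n : ℕ) where
  open Graph G hiding (V; order)

  private
    module H = Graph (G ⊠ K n)

  ∑-⊠ : ∀ f → ∑ H.vertices f ≡ ∑[ x ← vertices ] ∑[ i ← allFin n ] f (x , i)
  ∑-⊠ f = trans
    (∑-↭ f (vertices-unique (G ⊠ K n)) (Unique.cartesianProduct⁺ (vertices-unique G) (Unique.allFin⁺ n))
           (∈-vertices (G ⊠ K n)) (λ (x , i) → ∈-cartesianProduct⁺ (∈-vertices G x) (∈-allFin i)))
    (∑-cartesianProduct f vertices (allFin n))

  inside outside : (V G × Fin n → Bool) → V G → ℕ
  inside  A x = ∑[ i ← allFin n ] ι (A (x , i))
  outside A x = ∑[ i ← allFin n ] ι (not (A (x , i)))

  inside+outside : ∀ A x → inside A x + outside A x ≡ n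
  inside+outside A x = begin
    inside A x + outside A x                                  ≡⟨ sym (∑-+ (allFin n)) ⟩
    ∑[ i ← allFin n ] (ι (A (x , i)) + ι (not (A (x , i))))   ≡⟨ ∑-cong (allFin n) (λ i → ι-not (A (x , i))) ⟩
    ∑[ _ ← allFin n ] 1                                       ≡⟨ ∑-const 1 (allFin n) ⟩
    length (allFin n) * 1                                     ≡⟨ *-identityʳ _ ⟩
    length (allFin n)                                         ≡⟨ length-tabulate id ⟩
    n                                                         ∎
    where open ≡-Reasoning

  ⊠-edge : ∀ {x y} i j → x ~ y → (x , i) H.~ (y , j)
  ⊠-edge i j x~y with i Fin.≟ j
  ... | yes i≡j = inj₂ (inj₁ (i≡j , x~y))
  ... | no  i≢j = inj₂ (inj₂ (x~y , i≢j))

  -- Distinctness excludes x = y with i = j, where `adj⁺` is 1 but the product has no loop.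
  adj-⊠ : ∀ x i y j → (x , i) ≢ (y , j) → adj (G ⊠ K n) (x , i) (y , j) ≡ adj⁺ G x y
  adj-⊠ x i y j u≢v = byFibres (x ≟ y)
    where
    u~?v : Dec ((x , i) H.~ (y , j))
    u~?v = (x , i) H.~? (y , j)
    byFibres : Dec (x ≡ y) → ⟦ u~?v ⟧ ≡ adj⁺ G x y
    byFibres (yes refl) = trans (⟦⟧-true u~?v (inj₁ (refl , λ i≡j → u≢v (cong (x ,_) i≡j))))
      (sym (cong₂ _+_ (⟦⟧-true (x ≟ x) refl) (⟦⟧-false (x ~? x) (irrefl refl))))
    byFibres (no x≢y) = trans (⟦⟧-cong u~?v (x ~? y) base (⊠-edge i j))
      (sym (cong (_+ adj G x y) (⟦⟧-false (x ≟ y) x≢y)))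
      where
      base : (x , i) H.~ (y , j) → x ~ y
      base (inj₁ (x≡y , _))        = contradiction x≡y x≢y
      base (inj₂ (inj₁ (_ , x~y))) = x~y
      base (inj₂ (inj₂ (x~y , _))) = x~y

  -- Adjacency depends only on the base vertices, so for fixed `x` and `y` the sum over `i` and `j`
  -- factors into the two fibre counts.
  ∣∂∣≡cut : ∀ A → ∣ ∂ (G ⊠ K n) A ∣ ≡ cut G (inside A) (outside A)
  ∣∂∣≡cut A = begin
    ∣ ∂ (G ⊠ K n) A ∣
      ≡⟨ ∣∂_∣ (G ⊠ K n) A ⟩
    ∑[ u ← H.vertices ] ∑[ v ← H.vertices ] (adj (G ⊠ K n) u v * (ι (A u) * ι (not (A v))))
      ≡⟨ ∑-cong H.vertices (λ u → ∑-cong H.vertices (λ v → pointwise u v)) ⟩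
    ∑[ u ← H.vertices ] ∑[ v ← H.vertices ] term (proj₁ u) (proj₂ u) (proj₁ v) (proj₂ v)
      ≡⟨ trans (∑-cong H.vertices (λ u → ∑-⊠ (λ v → term (proj₁ u) (proj₂ u) (proj₁ v) (proj₂ v))))
               (∑-⊠ (λ u → ∑[ y ← vertices ] ∑[ j ← allFin n ] term (proj₁ u) (proj₂ u) y j)) ⟩
    ∑[ x ← vertices ] ∑[ i ← allFin n ] ∑[ y ← vertices ] ∑[ j ← allFin n ] term x i y j
      ≡⟨ ∑-cong vertices (λ x → ∑-swap (λ i y → ∑[ j ← allFin n ] term x i y j) (allFin n) vertices) ⟩
    ∑[ x ← vertices ] ∑[ y ← vertices ] ∑[ i ← allFin n ] ∑[ j ← allFin n ] term x i y j
      ≡⟨ ∑-cong vertices (λ x → ∑-cong vertices (λ y → collect x y)) ⟩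
    cut G (inside A) (outside A) ∎
    where
    open ≡-Reasoning
    term : V G → Fin n → V G → Fin n → ℕ
    term x i y j = adj⁺ G x y * (ι (A (x , i)) * ι (not (A (y , j))))
    pointwise : ∀ u v → adj (G ⊠ K n) u v * (ι (A u) * ι (not (A v))) ≡ term (proj₁ u) (proj₂ u) (proj₁ v) (proj₂ v)
    pointwise u@(x , i) v@(y , j) = bySide (A u) (A v) refl refl
      where
      -- Both sides vanish unless `u` is in `A` and `v` is not; then the two differ, as `adj-⊠`
      -- requires.
      bySide : ∀ p q → A u ≡ p → A v ≡ q → adj (G ⊠ K n) u v * (ι p * ι (not q)) ≡ adj⁺ G x y * (ι p * ι (not q))
      bySide false q     _  _  = trans (*-zeroʳ (adj (G ⊠ K n) u v)) (sym (*-zeroʳ (adj⁺ G x y)))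
      bySide true  true  _  _  = trans (*-zeroʳ (adj (G ⊠ K n) u v)) (sym (*-zeroʳ (adj⁺ G x y)))
      bySide true  false Au Av = cong (_* 1) (adj-⊠ x i y j (λ u≡v →
        contradiction (trans (sym Au) (trans (cong A u≡v) Av)) λ ()))
    collect : ∀ x y → ∑[ i ← allFin n ] ∑[ j ← allFin n ] term x i y j ≡ adj⁺ G x y * (inside A x * outside A y)
    collect x y = begin
      ∑[ i ← allFin n ] ∑[ j ← allFin n ] (adj⁺ G x y * (ι (A (x , i)) * ι (not (A (y , j)))))
        ≡⟨ ∑-cong (allFin n) (λ i → ∑-*ˡ (adj⁺ G x y) (allFin n)) ⟩
      ∑[ i ← allFin n ] (adj⁺ G x y * ∑[ j ← allFin n ] (ι (A (x , i)) * ι (not (A (y , j)))))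
        ≡⟨ ∑-*ˡ (adj⁺ G x y) (allFin n) ⟩
      adj⁺ G x y * ∑[ i ← allFin n ] ∑[ j ← allFin n ] (ι (A (x , i)) * ι (not (A (y , j))))
        ≡⟨ cong (adj⁺ G x y *_) (trans (∑-cong (allFin n) (λ i → ∑-*ˡ (ι (A (x , i))) (allFin n)))
                                       (∑-*ʳ (outside A y) (allFin n))) ⟩
      adj⁺ G x y * (inside A x * outside A y) ∎

  -- A fibre is a clique, so two of its vertices on the same side of the cut keep their edge.
  fibreReachable : ∀ A x i j → A (x , i) ≡ A (x , j) → Reachable ((G ⊠ K n) -ₑ ∂ (G ⊠ K n) A) (x , i) (x , j)
  fibreReachable A x i j eq with i Fin.≟ j
  ... | yes refl = ε
  ... | no  i≢j  = sameSide (G ⊠ K n) A (inj₁ (refl , i≢j)) eq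

  module Block (x₀ : V G) (T : Fin n → Bool) where

    -- Covers two extremal sets at once: the whole fibre over `x₀` (t = n) and a triangle in it (t =
    -- 3).
    block : V G × Fin n → Bool
    block (x , i) = does (x₀ ≟ x) ∧ T i

    t : ℕ
    t = ∑[ i ← allFin n ] ι (T i)

    inside-block : ∀ x → inside block x ≡ ⟦ x₀ ≟ x ⟧ * t
    inside-block x = trans (∑-cong (allFin n) (λ i → ι-∧ (does (x₀ ≟ x)) (T i))) (∑-*ˡ ⟦ x₀ ≟ x ⟧ (allFin n))
      where
      ι-∧ : ∀ p q → ι (p ∧ q) ≡ ι p * ι q
      ι-∧ true  q = sym (*-identityˡ (ι q))
      ι-∧ false q = refl

    ∑-inside-block : ∀ (f : V G → ℕ) → ∑[ x ← vertices ] (inside block x * f x) ≡ t * f x₀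
    ∑-inside-block f = trans
      (∑-cong vertices (λ x → trans (cong (λ s → s * f x) (inside-block x)) (*-assoc ⟦ x₀ ≟ x ⟧ t (f x))))
      (∑-vertices-δ G x₀ (λ x → t * f x))

    -- The block is a clique, so all of its ordered pairs count, equal ones included.
    cut-inside-inside : cut G (inside block) (inside block) ≡ t * t
    cut-inside-inside = begin
      ∑[ x ← vertices ] ∑[ y ← vertices ] (adj⁺ G x y * (inside block x * inside block y))
        ≡⟨ ∑-cong vertices (λ x → trans
             (∑-cong vertices (λ y → rotate (adj⁺ G x y) (inside block x) (inside block y)))
             (∑-inside-block (λ y → inside block x * adj⁺ G x y))) ⟩
      ∑[ x ← vertices ] (t * (inside block x * adj⁺ G x x₀))
        ≡⟨ ∑-*ˡ t vertices ⟩
      t * ∑[ x ← vertices ] (inside block x * adj⁺ G x x₀)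
        ≡⟨ cong (t *_) (∑-inside-block (λ x → adj⁺ G x x₀)) ⟩
      t * (t * adj⁺ G x₀ x₀)
        ≡⟨ cong (λ c → t * (t * c)) (cong₂ _+_ (⟦⟧-true (x₀ ≟ x₀) refl) (⟦⟧-false (x₀ ~? x₀) (irrefl refl))) ⟩
      t * (t * 1)
        ≡⟨ cong (t *_) (*-identityʳ t) ⟩
      t * t ∎
      where
      open ≡-Reasoning
      rotate : ∀ c p q → c * (p * q) ≡ q * (p * c)
      rotate = solve-∀

    ∣∂block∣ : ∣ ∂ (G ⊠ K n) block ∣ + t * t ≡ n * (t * suc (deg G x₀))
    ∣∂block∣ = begin
      ∣ ∂ (G ⊠ K n) block ∣ + t * t
        ≡⟨ cong₂ _+_ (∣∂∣≡cut block) (sym cut-inside-inside) ⟩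
      cut G (inside block) (outside block) + cut G (inside block) (inside block)
        ≡⟨ cut-complement G n {inside block} {outside block} (inside+outside block) ⟩
      n * ∑[ x ← vertices ] (inside block x * deg⁺ G x)
        ≡⟨ cong (n *_) (trans (∑-inside-block (deg⁺ G)) (cong (t *_) (deg⁺≡1+deg G x₀))) ⟩
      n * (t * suc (deg G x₀)) ∎
      where open ≡-Reasoning

-- The three extremal cuts

fibreTriple : ∀ (G : Graph) n (R : V G × Fin n → Set) x {i j l} → i ≢ j → i ≢ l → j ≢ l →
              R (x , i) → R (x , j) → R (x , l) → ∃[ us ] (Unique us × All R us × 3 ≤ length us)
fibreTriple G n R x i≢j i≢l j≢l ri rj rl =
  _ , ((i≢j ∘ cong proj₂) ∷ (i≢l ∘ cong proj₂) ∷ []) ∷ ((j≢l ∘ cong proj₂) ∷ []) ∷ [] ∷ []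
    , ri ∷ rj ∷ rl ∷ [] , ≤-refl

∑-allFin-1 : ∀ n → ∑[ _ ← allFin n ] 1 ≡ n
∑-allFin-1 n = trans (∑-const 1 (allFin n)) (trans (*-identityʳ _) (length-tabulate id))

module _ (G : Graph) (j : ℕ) (3≤m : 3 ≤ order G) where
  open Graph G hiding (V; order)

  private
    n = 4 + j
    H = G ⊠ K n

    i₀ i₁ i₂ i₃ : Fin n
    i₀ = 0F
    i₁ = 1F
    i₂ = 2F
    i₃ = 3F

  Attained : ℕ → Set₁
  Attained q = Σ[ S ∈ EdgeSet H ] (Is3RestrictedEdgeCut H S × ∣ S ∣ ≡ q)

  ∃-≢ : ∀ x → ∃[ z ] does (x ≟ z) ≡ false
  ∃-≢ x = ∃-∉ G (λ v → does (x ≟ v)) (≤-trans (s≤s (≤-reflexive (∑-≟ G x))) (≤-trans (n≤1+n 2) 3≤m))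

  -- Every fibre lies on one side of this cut, so each component contains a whole fibre. If δ = 0
  -- the cut is empty.
  fibreAttained : ∀ x₀ → deg G x₀ ≡ δ G → Attained (n ^ 2 * δ G)
  fibreAttained x₀ deg≡δ = ∂ H block , (disconnected , components) , size
    where
    open Block G n x₀ (const true)
    disconnected : IsEdgeCut H (∂ H block)
    disconnected = ∂-isEdgeCut H block {x₀ , i₀} {proj₁ (∃-≢ x₀) , i₀}
      (cong (_∧ true) (≟-true G x₀)) (cong (_∧ true) (proj₂ (∃-≢ x₀)))
    components : EachComponentHasAtLeast 3 (H -ₑ ∂ H block)
    components (x , i) = fibreTriple G n (Reachable (H -ₑ ∂ H block) (x , i)) x {i₀} {i₁} {i₂} (λ ()) (λ ()) (λ ())
      (reach i₀) (reach i₁) (reach i₂)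
      where
      reach : ∀ l → Reachable (H -ₑ ∂ H block) (x , i) (x , l)
      reach l = fibreReachable G n block x i l refl
    size : ∣ ∂ H block ∣ ≡ n ^ 2 * δ G
    size = +-cancelʳ-≡ (n * n) _ _ (begin
      ∣ ∂ H block ∣ + n * n         ≡⟨ cong (λ s → ∣ ∂ H block ∣ + s * s) (sym (∑-allFin-1 n)) ⟩
      ∣ ∂ H block ∣ + t * t         ≡⟨ ∣∂block∣ ⟩
      n * (t * suc (deg G x₀))      ≡⟨ cong₂ (λ s d → n * (s * suc d)) (∑-allFin-1 n) deg≡δ ⟩
      n * (n * suc (δ G))           ≡⟨ expand n (δ G) ⟩
      n ^ 2 * δ G + n * n           ∎)
      where
      open ≡-Reasoning
      expand : ∀ n d → n * (n * suc d) ≡ (n * (n * 1)) * d + n * n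
      expand = solve-∀

  module _ (1≤δ : 1 ≤ δ G) (δ≤∂ : BoundariesAtLeastδ G) where

    -- Above layer 0 each fibre retains n - 1 ≥ 3 mutually adjacent vertices; layer 0 itself is a
    -- copy of `G`, handled by `threeReachable`.
    layerAttained : V G → Attained ((n ∸ 1) * (order G + 2 * e G))
    layerAttained x₀ = ∂ H layer , (disconnected , components) , size
      where
      isZero : Fin n → Bool
      isZero 0F          = true
      isZero (Fin.suc _) = false
      layer : V G × Fin n → Bool
      layer (_ , i) = isZero i
      R : V G × Fin n → V G × Fin n → Set
      R = Reachable (H -ₑ ∂ H layer)
      disconnected : IsEdgeCut H (∂ H layer)
      disconnected = ∂-isEdgeCut H layer {x₀ , i₀} {x₀ , i₁} refl refl
      lift : ∀ {x y} → Reachable G x y → R (x , i₀) (y , i₀)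
      lift = gmap (_, i₀) (λ x~y → ⊠-edge G n i₀ i₀ x~y , λ (_ , ≢) → ≢ refl)
      liftTriple : ∀ x → ∃[ us ] (Unique us × All (Reachable G x) us × 3 ≤ length us) →
                   ∃[ us ] (Unique us × All (R (x , i₀)) us × 3 ≤ length us)
      liftTriple x (us , uus , reach , 3≤us) =
        map (_, i₀) us , Unique.map⁺ (cong proj₁) uus , All.map⁺ (All.map lift reach)
        , ≤-trans 3≤us (≤-reflexive (sym (length-map (_, i₀) us)))
      components : EachComponentHasAtLeast 3 (H -ₑ ∂ H layer)
      components (x , 0F)        = liftTriple x (threeReachable G 1≤δ δ≤∂ 3≤m x)
      components (x , Fin.suc i) = fibreTriple G n (R (x , Fin.suc i)) x {i₁} {i₂} {i₃} (λ ()) (λ ()) (λ ())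
        (reach 0F) (reach 1F) (reach 2F)
        where
        reach : ∀ l → R (x , Fin.suc i) (x , Fin.suc l)
        reach l = fibreReachable G n layer x (Fin.suc i) (Fin.suc l) refl
      inside≡1 : ∀ x → inside G n layer x ≡ 1
      inside≡1 x = cong suc (∑-tabulate-zero (3 + j) Fin.suc (λ i → ι (layer (x , i))) (λ _ → refl))
      outside≡ : ∀ x → outside G n layer x ≡ n ∸ 1
      outside≡ x = suc-injective (trans (cong (_+ outside G n layer x) (sym (inside≡1 x))) (inside+outside G n layer x))
      size : ∣ ∂ H layer ∣ ≡ (n ∸ 1) * (order G + 2 * e G)
      size = begin
        ∣ ∂ H layer ∣
          ≡⟨ ∣∂∣≡cut G n layer ⟩
        cut G (inside G n layer) (outside G n layer)
          ≡⟨ ∑-cong vertices (λ x → ∑-cong vertices (λ y →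
               cong₂ (λ p q → adj⁺ G x y * (p * q)) (inside≡1 x) (outside≡ y))) ⟩
        ∑[ x ← vertices ] ∑[ y ← vertices ] (adj⁺ G x y * (1 * (n ∸ 1)))
          ≡⟨ trans (∑-cong vertices (λ x → ∑-*ʳ (1 * (n ∸ 1)) vertices)) (∑-*ʳ (1 * (n ∸ 1)) vertices) ⟩
        ∑ vertices (deg⁺ G) * (1 * (n ∸ 1))
          ≡⟨ cong₂ _*_ (∑-deg⁺ G) (*-identityˡ (n ∸ 1)) ⟩
        (order G + 2 * e G) * (n ∸ 1)
          ≡⟨ *-comm (order G + 2 * e G) (n ∸ 1) ⟩
        (n ∸ 1) * (order G + 2 * e G) ∎
        where open ≡-Reasoning

    triangleAttained : ∀ x₀ → deg G x₀ ≡ δ G → Attained (3 * n * δ G + 3 * n ∸ 9)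
    triangleAttained x₀ deg≡δ = ∂ H block , (disconnected , components) , size
      where
      low : Fin n → Bool
      low 0F                              = true
      low 1F                              = true
      low 2F                              = true
      low (Fin.suc (Fin.suc (Fin.suc _))) = false
      open Block G n x₀ low
      R : V G × Fin n → V G × Fin n → Set
      R = Reachable (H -ₑ ∂ H block)
      disconnected : IsEdgeCut H (∂ H block)
      disconnected = ∂-isEdgeCut H block {x₀ , i₀} {x₀ , i₃}
        (cong (_∧ true) (≟-true G x₀)) (cong (_∧ false) (≟-true G x₀))
      y₀ : V G
      y₀ = proj₁ (neighbour G 1≤δ δ≤∂ 3≤m x₀)
      x₀~y₀ : x₀ ~ y₀
      x₀~y₀ = proj₂ (neighbour G 1≤δ δ≤∂ 3≤m x₀)
      components : EachComponentHasAtLeast 3 (H -ₑ ∂ H block)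
      components (x , i) = byFibre (x₀ ≟ x) (low i) refl
        where
        Triple : Set
        Triple = ∃[ us ] (Unique us × All (R (x , i)) us × 3 ≤ length us)
        triple : ∀ y → R (x , i) (y , i₀) → R (x , i) (y , i₁) → R (x , i) (y , i₂) → Triple
        triple y = fibreTriple G n (R (x , i)) y {i₀} {i₁} {i₂} (λ ()) (λ ()) (λ ())
        byFibre : Dec (x₀ ≡ x) → ∀ b → low i ≡ b → Triple
        byFibre (yes refl) true low-i = triple x (reach i₀ low-i) (reach i₁ low-i) (reach i₂ low-i)
          where
          reach : ∀ l → low i ≡ low l → R (x , i) (x , l)
          reach l eq = fibreReachable G n block x i l (cong (does (x₀ ≟ x) ∧_) eq)
        -- Only n - 3 vertices of this fibre remain, perhaps a single one, so the triple is taken in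
        -- the fibre over a neighbour `y₀`, which lies entirely outside the block.
        byFibre (yes refl) false low-i = triple y₀ (reach i₀) (reach i₁) (reach i₂)
          where
          reach : ∀ l → R (x , i) (y₀ , l)
          reach l = sameSide H block (⊠-edge G n i l x₀~y₀)
            (trans (cong₂ _∧_ (≟-true G x₀) low-i)
                   (sym (cong (_∧ low l) (dec-false (x₀ ≟ y₀) (λ x₀≡y₀ → irrefl x₀≡y₀ x₀~y₀)))))
        byFibre (no x₀≢x) _ _ = triple x (reach i₀) (reach i₁) (reach i₂)
          where
          reach : ∀ l → R (x , i) (x , l)
          reach l = fibreReachable G n block x i l (trans (cong (_∧ low i) x₀≟x) (sym (cong (_∧ low l) x₀≟x)))
            where
            x₀≟x : does (x₀ ≟ x) ≡ false
            x₀≟x = dec-false (x₀ ≟ x) x₀≢x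
      t≡3 : t ≡ 3
      t≡3 = cong (3 +_) (∑-tabulate-zero (suc j) (λ i → Fin.suc (Fin.suc (Fin.suc i))) (ι ∘ low) (λ _ → refl))
      size : ∣ ∂ H block ∣ ≡ 3 * n * δ G + 3 * n ∸ 9
      size = begin
        ∣ ∂ H block ∣                   ≡⟨ sym (m+n∸n≡m ∣ ∂ H block ∣ 9) ⟩
        ∣ ∂ H block ∣ + 9 ∸ 9           ≡⟨ cong (λ s → ∣ ∂ H block ∣ + s * s ∸ 9) (sym t≡3) ⟩
        ∣ ∂ H block ∣ + t * t ∸ 9       ≡⟨ cong (_∸ 9) ∣∂block∣ ⟩
        n * (t * suc (deg G x₀)) ∸ 9    ≡⟨ cong₂ (λ s d → n * (s * suc d) ∸ 9) t≡3 deg≡δ ⟩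
        n * (3 * suc (δ G)) ∸ 9         ≡⟨ cong (_∸ 9) (expand n (δ G)) ⟩
        3 * n * δ G + 3 * n ∸ 9         ∎
        where
        open ≡-Reasoning
        expand : ∀ n d → n * (3 * suc d) ≡ 3 * n * d + 3 * n
        expand = solve-∀

-- The minimum of the three values

⊓-preserves : (P : ℕ → Set₁) → ∀ a b → P a → P b → P (a ⊓ b)
⊓-preserves P a b pa pb with ⊓-sel a b
... | inj₁ eq = subst P (sym eq) pa
... | inj₂ eq = subst P (sym eq) pb

theorem3p2 : (G : Graph) (n : ℕ) →
    MaximallyEdgeConnected G → order G ≥ 3 → n ≥ 4 →
    λ₃[ G ⊠ K n ]≡ [ (n ^ 2 * δ G)
    ⊓ ((n ∸ 1) * (order G + 2 * e G))
    ⊓ (3 * n * δ G + 3 * n ∸ 9) ]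
theorem3p2 G (suc (suc (suc (suc j)))) (_ , δ≤cuts) 3≤m (s≤s (s≤s (s≤s (s≤s z≤n)))) = byδ (δ G ≟ℕ 0)
  where
  n = 4 + j
  v₁ = n ^ 2 * δ G
  v₂ = (n ∸ 1) * (order G + 2 * e G)
  v₃ = 3 * n * δ G + 3 * n ∸ 9

  δ≤∂ : BoundariesAtLeastδ G
  δ≤∂ X Xu Xv = δ≤cuts (∂ G X) (∂-isEdgeCut G X Xu Xv)

  someVertex : V G
  someVertex = Inverse.from (Graph.finite G) (fromℕ< (≤-trans (s≤s z≤n) 3≤m))
  x₀ : V G
  x₀ = proj₁ (minDegree G someVertex)
  deg≡δ : deg G x₀ ≡ δ G
  deg≡δ = proj₂ (minDegree G someVertex)

  byδ : Dec (δ G ≡ 0) → λ₃[ G ⊠ K n ]≡ [ v₁ ⊓ v₂ ⊓ v₃ ]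
  -- The first value is 0, hence so is the minimum, and the fibre cut attains it; the lower bound is
  -- trivial.
  byδ (yes δ≡0) = subst (Attained G j 3≤m) (sym (trans (cong (λ t → t ⊓ v₂ ⊓ v₃) v₁≡0) (sym v₁≡0))) (fibreAttained G j 3≤m x₀ deg≡δ)
                , λ S _ → ≤-trans (≤-reflexive (cong (λ t → t ⊓ v₂ ⊓ v₃) v₁≡0)) z≤n
    where
    v₁≡0 : v₁ ≡ 0
    v₁≡0 = trans (cong (n ^ 2 *_) δ≡0) (*-zeroʳ (n ^ 2))
  -- The minimum is one of three attained values. For the lower bound, a restricted cut is reduced
  -- to a vertex boundary and this to fibre counts.
  byδ (no δ≢0) = ⊓-preserves (Attained G j 3≤m) (v₁ ⊓ v₂) v₃
                   (⊓-preserves (Attained G j 3≤m) v₁ v₂ (fibreAttained G j 3≤m x₀ deg≡δ) (layerAttained G j 3≤m 1≤δ δ≤∂ x₀))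
                   (triangleAttained G j 3≤m 1≤δ δ≤∂ x₀ deg≡δ)
               , λ S → restrictedCut-≥ (G ⊠ K n) S (λ X 3≤X 3≤Xᶜ →
                   subst (v₁ ⊓ v₂ ⊓ v₃ ≤_) (sym (∣∂∣≡cut G n X))
                     (cut-lower-bound G δ≤∂ (3 + j) (s≤s (s≤s (s≤s z≤n))) 3≤m 1≤δ (inside+outside G n X)
                       (subst (3 ≤_) (∑-⊠ G n (ι ∘ X)) 3≤X) (subst (3 ≤_) (∑-⊠ G n (ι ∘ not ∘ X)) 3≤Xᶜ)))
    where
    1≤δ : 1 ≤ δ G
    1≤δ = n≢0⇒n>0 δ≢0
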